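{- For $n\ge1$ let $u(n)$ be the sum of $\mathrm{area}(w)$ over all Catalan words $w$ of length $n$ avoiding the pattern $(\geq,\geq)$. Then \[ \sum_{n\ge1}u(n)x^n=\frac{\left(-2 x^{3}+x^{2}+3 x -1\right) \sqrt{1-2x-3x^{2}}+2 x^{4}+7 x^{3}-4 x +1}{6 x^{6}+4 x^{5}-2 x^{4}}, \] for all $n\ge1$ \[ u(n)=\frac{1}{2}\left(3^{n+1}+2T_{n+1}-T_{n+2}-3T_{n+3}+T_{n+4}\right), \] and $u(n)\sim 3^{n+1}/2$ as $n\to\infty$.
   Context: A Catalan word of length $n\ge 0$ is a sequence $w=w_1\cdots w_n$ of non-negative integers with $w_1=0$ and $0\le w_i\le w_{i-1}+1$ for $i=2,\dots,n$. It avoids the pattern $(\geq,\geq)$ if there is no index $i$ with $w_i\ge w_{i+1}\ge w_{i+2}$. $\mathrm{area}(w)=\sum_{i=1}^n(w_i+1)$. $T_n=\sum_{k=0}^{n}\binom{n}{k}\binom{n-k}{k}$ is the central trinomial coefficient (the coefficient of $x^n$ in $(1+x+x^2)^n$). -}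

module Defs where

open import Data.Bool using (Bool; true; false; _∧_; not)
open import Data.Nat using (ℕ; zero; suc; _+_; _*_; _∸_; _^_; _≡ᵇ_; _≤ᵇ_)
open import Data.Nat.Combinatorics using (_C_)
open import Data.Nat.ListAction using (sum)
open import Data.List using (List; []; _∷_; [_]; map; upTo; concatMap; filterᵇ; foldr)
open import Data.Integer using (ℤ; +_) renaming (_+_ to _+ℤ_; _*_ to _*ℤ_)

steps : ℕ → List ℕ → Bool
steps p []       = true
steps p (y ∷ ys) = (y ≤ᵇ suc p) ∧ steps y ys

isCatalan : List ℕ → Bool
isCatalan []       = true
isCatalan (x ∷ xs) = (x ≡ᵇ 0) ∧ steps x xs

avoidsGeGe : List ℕ → Bool
avoidsGeGe (a ∷ b ∷ c ∷ rest) = not ((b ≤ᵇ a) ∧ (c ≤ᵇ b)) ∧ avoidsGeGe (b ∷ c ∷ rest)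
avoidsGeGe _ = true

area : List ℕ → ℕ
area w = sum (map suc w)

allSeqs : ℕ → ℕ → List (List ℕ)
allSeqs zero    m = [ [] ]
allSeqs (suc n) m = concatMap (λ x → map (x ∷_) (allSeqs n m)) (upTo m)

-- Catalan words of length n avoiding (≥,≥).  Every Catalan word of length n
-- has all entries < n, so allSeqs n n contains all of them.
avoiders : ℕ → List (List ℕ)
avoiders n = filterᵇ (λ w → isCatalan w ∧ avoidsGeGe w) (allSeqs n n)

u : ℕ → ℕ
u n = sum (map area (avoiders n))

-- central trinomial coefficient  T n = Σ_{k=0}^{n} C(n,k) C(n-k,k)
T : ℕ → ℕ
T n = sum (map (λ k → (n C k) * ((n ∸ k) C k)) (upTo (suc n)))

PS : Set
PS = ℕ → ℤ

sumℤ : List ℤ → ℤ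
sumℤ = foldr _+ℤ_ (+ 0)

_⊛_ : PS → PS → PS
(f ⊛ g) n = sumℤ (map (λ i → f i *ℤ g (n ∸ i)) (upTo (suc n)))

poly : List ℤ → PS
poly []       n       = + 0
poly (c ∷ cs) zero    = c
poly (c ∷ cs) (suc n) = poly cs n

U : PS
U zero    = + 0
U (suc n) = + u (suc n)

{-# OPTIONS --safe #-}
module Submission where

-- Let h be one more than the last letter read. The areas of the continuations of a word satisfy a
-- linear three-term recurrence in h over ℤ[[x]], whose characteristic equation
-- x(1+x)r² = (1+x)r - 1 has one root r in ℤ[[x]]; it also yields the square root
-- S = (1+x)(1-2xr) of 1-2x-3x². The source of the recurrence is resonant, being itself a multiple
-- of r^h, so the solution is r^h times a quadratic polynomial in h, plus a constant; h = 0 gives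
-- the generating function. The trinomial coefficients satisfy another three-term recurrence with
-- root z = (1+x)r - 1, whence T = 1/S and the closed form. Finally T(n+1) ≤ 3T(n) and
-- T² = 1/(1-2x-3x²) give (n+1)T(n)² ≤ 9ⁿ, so that T(n) = o(3ⁿ).

open import Defs
open import Algebra.Bundles using (CommutativeRing)
import Algebra.Solver.Ring as RingSolver
open import Algebra.Solver.Ring.AlmostCommutativeRing using (_-Raw-AlmostCommutative⟶_; fromCommutativeRing)
open import Data.Nat using (ℕ; zero; suc)
open import Data.Product using (_×_; _,_; proj₁; proj₂)
open import Data.Integer using (ℤ; +_; -[1+_])
import Data.Integer as ℤ
import Data.Integer.Properties as ℤ
open import Data.List using (List; _∷_; [])
import Data.Maybe as Maybe
open import Level using (0ℓ)
import Relation.Binary.PropositionalEquality as ≡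
open import Relation.Nullary.Decidable using (dec⇒maybe)

-- The recurrence in h has order two but only one boundary equation, at h = 0. The missing condition
-- is membership in ℤ[[x]]: the other root of the characteristic equation, 1/(x(1+x)r), has a pole
-- at x = 0. Concretely, a coefficient at h+1 is determined by the same coefficient at h and by
-- lower ones at h+1 and h+2, so a homogeneous solution vanishes. Closed forms therefore only have
-- to be verified. Nothing is divided. The area series is multiplied by a common denominator `K`,
-- and each verification is an ideal membership: the difference of two sides is a combination of
-- elements known to vanish, such as `κ`. The solver checks that combination as a polynomial
-- identity in which x, r, h and p = r^h are independent variables. Each formula is thus needed both
-- as a ring element and as a solver polynomial, which is what `Expressions` provides.

record Expressions (A : Set) : Set where
  infixl 7 _⊗_
  infixl 6 _⊕_ _⊖_
  infix  8 ⊝_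
  field
    _⊕_ _⊗_ : A → A → A
    ⊝_      : A → A
    #       : ℤ → A

  _⊖_ : A → A → A
  a ⊖ b = a ⊕ ⊝ b

  horner : A → List ℤ → A
  horner x []       = # (+ 0)
  horner x (c ∷ cs) = # c ⊕ x ⊗ horner x cs

  -- `D` is 1-2x-3x², the discriminant of the characteristic polynomial, kept factored because
  -- cancelling 1-3x is used later. `K` collects the denominators of the area series: x² from the
  -- constant part, 2 from the quadratic in h, and D = S² because resonance costs a division by S
  -- for each power of h.
  D K : A → A
  D x = (# (+ 1) ⊕ x) ⊗ (# (+ 1) ⊖ # (+ 3) ⊗ x)
  K x = # (+ 2) ⊗ (x ⊗ x) ⊗ D x

  -- `S` is minus the derivative of the characteristic polynomial at r, hence a square root of its
  -- discriminant. `z` satisfies z = x(1+z+z²), the characteristic equation for trinomial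
  -- coefficients.
  κ S z : A → A → A
  κ x r = x ⊗ (# (+ 1) ⊕ x) ⊗ (r ⊗ r) ⊖ ((# (+ 1) ⊕ x) ⊗ r ⊖ # (+ 1))
  S x r = (# (+ 1) ⊕ x) ⊗ (# (+ 1) ⊖ # (+ 2) ⊗ x ⊗ r)
  z x r = (# (+ 1) ⊕ x) ⊗ r ⊖ # (+ 1)

  -- ĝ and b̂ solve the recurrences for the counts and for the areas scaled by K, with p = r^h.
  ĝ : A → A → A → A
  ĝ x r p = (# (+ 1) ⊕ x) ⊗ (p ⊗ (r ⊗ r))

  -- Undetermined coefficients: `α` matches the part of the source proportional to h r^h, and `γ`,
  -- the coefficient of the homogeneous solution r^h, is fixed by the boundary equation. The term 2D
  -- in `b̂` is K times 1/x², the constant solution for the constant part -1 of the source.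
  α γ : A → A → A
  α x r = (# (+ 1) ⊕ x) ⊗ (# (+ 1) ⊕ # (+ 3) ⊗ x) ⊗ r ⊖ (# (+ 1) ⊕ x) ⊗ (r ⊗ r) ⊖ # (+ 3) ⊗ x
  γ x r = (horner x (+ 6 ∷ + 8 ∷ -[1+ 1 ] ∷ -[1+ 3 ] ∷ []) ⊗ r ⊖ # (+ 2) ⊗ (# (+ 1) ⊕ x) ⊗ (r ⊗ r))
          ⊕ horner x (-[1+ 5 ] ∷ -[1+ 1 ] ∷ + 6 ∷ [])

  b̂ : A → A → A → A → A
  b̂ x r h p = p ⊗ ((x ⊗ x) ⊗ (α x r ⊗ (h ⊗ (# (+ 1) ⊕ h)) ⊕ # (+ 2) ⊗ h) ⊕ γ x r) ⊕ # (+ 2) ⊗ D x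

  -- The inhomogeneity left after eliminating f and a from the area equations; the differences g - 1
  -- stand for x f at the next height.
  source : A → A → A → A → A → A
  source x h g₀ g₁ g₂ =
    (# (+ 1) ⊕ (# (+ 1) ⊕ h)) ⊗ (g₁ ⊖ # (+ 1)) ⊖ (# (+ 1) ⊕ h) ⊗ (g₀ ⊖ # (+ 1))
    ⊕ x ⊗ x ⊗ ((# (+ 1) ⊕ (# (+ 1) ⊕ h)) ⊗ g₂)

-- The ring is abstract here because the solver would otherwise unfold convolutions.
module KernelMethod
  (R : CommutativeRing 0ℓ 0ℓ)
  (morphism : CommutativeRing.rawRing ℤ.+-*-commutativeRing -Raw-AlmostCommutative⟶ fromCommutativeRing R)
  where

  open CommutativeRing R hiding (_-_)
  open _-Raw-AlmostCommutative⟶_ morphism using (⟦_⟧)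
  open import Algebra.Properties.Ring ring using (-0#≈0#)
  open import Algebra.Properties.Group +-group using (x∙y⁻¹≈ε⇒x≈y; x≈y⇒x∙y⁻¹≈ε)
  open RingSolver (CommutativeRing.rawRing ℤ.+-*-commutativeRing) (fromCommutativeRing R) morphism
    (λ m n → Maybe.map (λ eq → reflexive (≡.cong ⟦_⟧ eq)) (dec⇒maybe (m ℤ.≟ n)))
    using (Polynomial; con; _:+_; _:*_; :-_; _:-_; _:=_; solve)

  values : Expressions Carrier
  values = record { _⊕_ = _+_ ; _⊗_ = _*_ ; ⊝_ = -_ ; # = ⟦_⟧ }

  polynomials : ∀ n → Expressions (Polynomial n)
  polynomials n = record { _⊕_ = _:+_ ; _⊗_ = _:*_ ; ⊝_ = :-_ ; # = con }

  open Expressions values public hiding (_⊕_; _⊗_; ⊝_; #)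
  module P {n : ℕ} = Expressions (polynomials n)

  -- Calculus of vanishing elements

  Null : Carrier → Set
  Null = _≈ 0#

  infixl 6 _⊕₀_ _⊖₀_
  infixl 7 _⊗₀_
  infixr 2 _from_

  _⊕₀_ : ∀ {a b} → Null a → Null b → Null (a + b)
  a≈0 ⊕₀ b≈0 = trans (+-cong a≈0 b≈0) (+-identityˡ 0#)

  _⊗₀_ : ∀ c {a} → Null a → Null (c * a)
  c ⊗₀ a≈0 = trans (*-congˡ a≈0) (zeroʳ c)

  _⊖₀_ : ∀ {a b} → Null a → Null b → Null (a ⊖ b)
  a≈0 ⊖₀ b≈0 = trans (+-cong a≈0 (trans (-‿cong b≈0) -0#≈0#)) (+-identityˡ 0#)

  null : ∀ {a b} → a ≈ b → Null (a ⊖ b)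
  null = x≈y⇒x∙y⁻¹≈ε

  _from_ : ∀ {a b e} → a ⊖ b ≈ e → Null e → a ≈ b
  eq from e≈0 = x∙y⁻¹≈ε⇒x≈y _ _ (trans eq e≈0)

  kernel-from-fixed-point : ∀ X r → r ≈ ⟦ + 1 ⟧ + X * ((⟦ + 1 ⟧ + X) * (r * r) ⊖ r) → Null (κ X r)
  kernel-from-fixed-point X r r-fixed = trans
    (solve 2 (λ X r → let 1# = con (+ 1) in P.κ X r := 1# :+ X :* ((1# :+ X) :* (r :* r) :- r) :- r) refl X r)
    (null (sym r-fixed))

  D-expanded : ∀ X → D X ≈ horner X (+ 1 ∷ -[1+ 1 ] ∷ -[1+ 2 ] ∷ [])
  D-expanded = solve 1 (λ X → P.D X := P.horner X (+ 1 ∷ -[1+ 1 ] ∷ -[1+ 2 ] ∷ [])) refl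

  module Recurrences (X r : Carrier) (kernel : Null (κ X r)) where

    S²≈D : S X r * S X r ≈ D X
    S²≈D = solve 2 (λ X r →
        P.S X r :* P.S X r :- P.D X := con (+ 4) :* X :* (con (+ 1) :+ X) :* P.κ X r)
      refl X r
      from _ ⊗₀ kernel

    -- The cofactors of κ here and below are quotients of a polynomial division by κ.
    ĝ-initial : ĝ X r ⟦ + 1 ⟧ ≈ ⟦ + 1 ⟧ + X * ((⟦ + 1 ⟧ + X) * ĝ X r (⟦ + 1 ⟧ * r))
    ĝ-initial = solve 2 (λ X r → let 1# = con (+ 1) in
        P.ĝ X r 1# :- (1# :+ X :* ((1# :+ X) :* P.ĝ X r (1# :* r))) := :- (1# :+ r :+ X :* r) :* P.κ X r)
      refl X r
      from _ ⊗₀ kernel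

    ĝ-step : ∀ p → (⟦ + 1 ⟧ + X) * ĝ X r (p * r) ≈ ĝ X r p + X * ((⟦ + 1 ⟧ + X) * ĝ X r (p * r * r)) + ⟦ + 0 ⟧
    ĝ-step p = solve 3 (λ X r p → let 1# = con (+ 1) in
        (1# :+ X) :* P.ĝ X r (p :* r) :- (P.ĝ X r p :+ X :* ((1# :+ X) :* P.ĝ X r (p :* r :* r)) :+ con (+ 0))
        := :- ((1# :+ X) :* p :* (r :* r)) :* P.κ X r)
      refl X r p
      from _ ⊗₀ kernel

    b̂-initial : let h = ⟦ + 0 ⟧; p = ⟦ + 1 ⟧ in
      b̂ X r h p ≈ K X * (ĝ X r p ⊖ ⟦ + 1 ⟧ + X * X * ĝ X r (p * r)) + X * ((⟦ + 1 ⟧ + X) * b̂ X r (⟦ + 1 ⟧ + h) (p * r))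
    b̂-initial = solve 2 (λ X r → let 1# = con (+ 1); h = con (+ 0); p = 1# in
        P.b̂ X r h p :- (P.K X :* (P.ĝ X r p :- 1# :+ X :* X :* P.ĝ X r (p :* r)) :+ X :* ((1# :+ X) :* P.b̂ X r (1# :+ h) (p :* r)))
        := (P.horner X (-[1+ 3 ] ∷ -[1+ 7 ] ∷ + 4 ∷ + 6 ∷ []) :+ P.horner X (+ 2 ∷ + 2 ∷ + 2 ∷ + 0 ∷ + 4 ∷ + 6 ∷ []) :* r) :* P.κ X r)
      refl X r
      from _ ⊗₀ kernel

    b̂-step : ∀ h p →
      (⟦ + 1 ⟧ + X) * b̂ X r (⟦ + 1 ⟧ + h) (p * r) ≈
      b̂ X r h p + X * ((⟦ + 1 ⟧ + X) * b̂ X r (⟦ + 1 ⟧ + (⟦ + 1 ⟧ + h)) (p * r * r))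
      + K X * source X h (ĝ X r p) (ĝ X r (p * r)) (ĝ X r (p * r * r))
    b̂-step h p = solve 4 (λ X r h p → let 1# = con (+ 1) in
        (1# :+ X) :* P.b̂ X r (1# :+ h) (p :* r) :-
        (P.b̂ X r h p :+ X :* ((1# :+ X) :* P.b̂ X r (1# :+ (1# :+ h)) (p :* r :* r))
         :+ P.K X :* P.source X h (P.ĝ X r p) (P.ĝ X r (p :* r)) (P.ĝ X r (p :* r :* r)))
        := p :*
           ( X :* X :* (P.horner X (+ 0 ∷ + 3 ∷ []) :+ P.horner X (-[1+ 0 ] ∷ -[1+ 3 ] ∷ -[1+ 2 ] ∷ []) :* r
                        :+ P.horner X (+ 1 ∷ + 1 ∷ []) :* (r :* r)) :* (h :* h)
          :+ X :* X :* (P.horner X (-[1+ 1 ] ∷ + 3 ∷ []) :+ P.horner X (-[1+ 0 ] ∷ -[1+ 9 ] ∷ -[1+ 8 ] ∷ []) :* r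
                        :+ P.horner X (+ 5 ∷ + 3 ∷ + 4 ∷ + 6 ∷ []) :* (r :* r)) :* h
          :+ (P.horner X (+ 6 ∷ + 2 ∷ -[1+ 5 ] ∷ []) :+ P.horner X (-[1+ 5 ] ∷ -[1+ 7 ] ∷ + 4 ∷ + 0 ∷ -[1+ 5 ] ∷ []) :* r
                        :+ P.horner X (+ 2 ∷ + 2 ∷ + 6 ∷ + 2 ∷ + 8 ∷ + 12 ∷ []) :* (r :* r))) :* P.κ X r)
      refl X r h p
      from _ ⊗₀ kernel

    -- The factor -x² turns `K` into the denominator of the theorem.
    gf-numerator : let p = ⟦ + 1 ⟧; h = ⟦ + 0 ⟧ in
      horner X (+ 0 ∷ + 0 ∷ -[1+ 0 ] ∷ []) * b̂ X r h p ≈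
      horner X (-[1+ 0 ] ∷ + 3 ∷ + 1 ∷ -[1+ 1 ] ∷ []) * S X r
      + horner X (+ 1 ∷ -[1+ 3 ] ∷ + 0 ∷ + 7 ∷ + 2 ∷ [])
    gf-numerator = solve 2 (λ X r → let p = con (+ 1); h = con (+ 0) in
        P.horner X (+ 0 ∷ + 0 ∷ -[1+ 0 ] ∷ []) :* P.b̂ X r h p :-
        (P.horner X (-[1+ 0 ] ∷ + 3 ∷ + 1 ∷ -[1+ 1 ] ∷ []) :* P.S X r
         :+ P.horner X (+ 1 ∷ -[1+ 3 ] ∷ + 0 ∷ + 7 ∷ + 2 ∷ []))
        := con (+ 2) :* X :* P.κ X r)
      refl X r
      from _ ⊗₀ kernel

    gf-denominator : horner X (+ 0 ∷ + 0 ∷ + 0 ∷ + 0 ∷ -[1+ 1 ] ∷ + 4 ∷ + 6 ∷ []) ≈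
                     horner X (+ 0 ∷ + 0 ∷ -[1+ 0 ] ∷ []) * K X
    gf-denominator = solve 2 (λ X r →
        P.horner X (+ 0 ∷ + 0 ∷ + 0 ∷ + 0 ∷ -[1+ 1 ] ∷ + 4 ∷ + 6 ∷ [])
        := P.horner X (+ 0 ∷ + 0 ∷ -[1+ 0 ] ∷ []) :* P.K X)
      refl X r

    pow : ℕ → Carrier
    pow zero    = ⟦ + 1 ⟧
    pow (suc h) = pow h * r

    height : ℕ → Carrier
    height zero    = ⟦ + 0 ⟧
    height (suc h) = ⟦ + 1 ⟧ + height h

    -- Solving the recurrences for counts and areas

    module AreaRecurrence
      (only-zero : ∀ (d : ℕ → Carrier) → d 0 ≈ X * ((⟦ + 1 ⟧ + X) * d 1) →
        (∀ h → (⟦ + 1 ⟧ + X) * d (suc h) ≈ d h + X * ((⟦ + 1 ⟧ + X) * d (suc (suc h)))) → ∀ h → Null (d h))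
      (f g a b : ℕ → Carrier)
      (g-eq   : ∀ h → g h ≈ ⟦ + 1 ⟧ + X * f (suc h))
      (f-zero : f 0 ≈ g 0)
      (f-suc  : ∀ h → f (suc h) + g h ≈ f h + g (suc h) + X * g (suc h))
      (b-eq   : ∀ h → b h ≈ X * (height (suc h) * f (suc h) + a (suc h)))
      (a-zero : a 0 ≈ b 0)
      (a-suc  : ∀ h → a (suc h) + b h ≈ a h + b (suc h) + X * (height (suc h) * g (suc h) + b (suc h)))
      where

      Solves : Carrier → (ℕ → Carrier) → (ℕ → Carrier) → Set
      Solves s₀ s u =
        (u 0 ≈ s₀ + X * ((⟦ + 1 ⟧ + X) * u 1)) ×
        (∀ h → (⟦ + 1 ⟧ + X) * u (suc h) ≈ u h + X * ((⟦ + 1 ⟧ + X) * u (suc (suc h))) + s h)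

      solution-unique : ∀ {s₀ s u v} → Solves s₀ s u → Solves s₀ s v → ∀ h → u h ≈ v h
      solution-unique {s₀} {s} {u} {v} (u₀ , uₛ) (v₀ , vₛ) h =
        x∙y⁻¹≈ε⇒x≈y _ _ (only-zero (λ h → u h ⊖ v h)
          (solve 6 (λ X s₀ u₀ u₁ v₀ v₁ → let 1# = con (+ 1) in
              (u₀ :- v₀) :- X :* ((1# :+ X) :* (u₁ :- v₁))
              := (u₀ :- (s₀ :+ X :* ((1# :+ X) :* u₁))) :- (v₀ :- (s₀ :+ X :* ((1# :+ X) :* v₁))))
            refl X s₀ (u 0) (u 1) (v 0) (v 1)
            from null u₀ ⊖₀ null v₀)
          (λ h → solve 8 (λ X s u₀ u₁ u₂ v₀ v₁ v₂ → let 1# = con (+ 1) in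
              (1# :+ X) :* (u₁ :- v₁) :- ((u₀ :- v₀) :+ X :* ((1# :+ X) :* (u₂ :- v₂)))
              := ((1# :+ X) :* u₁ :- (u₀ :+ X :* ((1# :+ X) :* u₂) :+ s))
                 :- ((1# :+ X) :* v₁ :- (v₀ :+ X :* ((1# :+ X) :* v₂) :+ s)))
            refl X (s h) (u h) (u (suc h)) (u (suc (suc h))) (v h) (v (suc h)) (v (suc (suc h)))
            from null (uₛ h) ⊖₀ null (vₛ h))
          h)

      -- Multiplying the difference equation for f by x and replacing x f by g - 1 leaves g alone.
      -- At h = 0 the equation f 0 = g 0 closes the system.
      g-solves : Solves ⟦ + 1 ⟧ (λ _ → ⟦ + 0 ⟧) g
      g-solves =
        (solve 5 (λ X g₀ g₁ f₀ f₁ → let 1# = con (+ 1) in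
            g₀ :- (1# :+ X :* ((1# :+ X) :* g₁))
            := (g₀ :- (1# :+ X :* f₁)) :+ X :* ((f₁ :+ g₀ :- (f₀ :+ g₁ :+ X :* g₁)) :+ (f₀ :- g₀)))
          refl X (g 0) (g 1) (f 0) (f 1)
          from null (g-eq 0) ⊕₀ X ⊗₀ (null (f-suc 0) ⊕₀ null f-zero)) ,
        (λ h → solve 6 (λ X g₀ g₁ g₂ f₁ f₂ → let 1# = con (+ 1) in
            (1# :+ X) :* g₁ :- (g₀ :+ X :* ((1# :+ X) :* g₂) :+ con (+ 0))
            := (g₁ :- (1# :+ X :* f₂)) :- (g₀ :- (1# :+ X :* f₁)) :+ X :* (f₂ :+ g₁ :- (f₁ :+ g₂ :+ X :* g₂)))
          refl X (g h) (g (suc h)) (g (suc (suc h))) (f (suc h)) (f (suc (suc h)))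
          from null (g-eq (suc h)) ⊖₀ null (g-eq h) ⊕₀ X ⊗₀ null (f-suc (suc h)))

      g-closed : ∀ h → g h ≈ ĝ X r (pow h)
      g-closed = solution-unique g-solves (ĝ-initial , λ h → ĝ-step (pow h))

      b-solves : Solves (g 0 ⊖ ⟦ + 1 ⟧ + X * X * g 1)
                        (λ h → source X (height h) (g h) (g (suc h)) (g (suc (suc h)))) b
      b-solves =
        (solve 8 (λ X g₀ g₁ f₁ a₀ a₁ b₀ b₁ → let 1# = con (+ 1); h₁ = 1# :+ con (+ 0) in
            b₀ :- (g₀ :- 1# :+ X :* X :* g₁ :+ X :* ((1# :+ X) :* b₁))
            := (b₀ :- X :* (h₁ :* f₁ :+ a₁))
               :+ X :* ((a₁ :+ b₀ :- (a₀ :+ b₁ :+ X :* (h₁ :* g₁ :+ b₁))) :+ (a₀ :- b₀))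
               :- (g₀ :- (1# :+ X :* f₁)))
          refl X (g 0) (g 1) (f 1) (a 0) (a 1) (b 0) (b 1)
          from null (b-eq 0) ⊕₀ X ⊗₀ (null (a-suc 0) ⊕₀ null a-zero) ⊖₀ null (g-eq 0)) ,
        (λ h → solve 12 (λ X h g₀ g₁ g₂ f₁ f₂ a₁ a₂ b₀ b₁ b₂ →
            let 1# = con (+ 1); h₁ = 1# :+ h; h₂ = 1# :+ h₁ in
            (1# :+ X) :* b₁ :- (b₀ :+ X :* ((1# :+ X) :* b₂) :+ P.source X h g₀ g₁ g₂)
            := (b₁ :- X :* (h₂ :* f₂ :+ a₂)) :- (b₀ :- X :* (h₁ :* f₁ :+ a₁))
               :+ X :* (a₂ :+ b₁ :- (a₁ :+ b₂ :+ X :* (h₂ :* g₂ :+ b₂)))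
               :- h₂ :* (g₁ :- (1# :+ X :* f₂)) :+ h₁ :* (g₀ :- (1# :+ X :* f₁)))
          refl X (height h) (g h) (g (suc h)) (g (suc (suc h))) (f (suc h)) (f (suc (suc h)))
            (a (suc h)) (a (suc (suc h))) (b h) (b (suc h)) (b (suc (suc h)))
          from null (b-eq (suc h)) ⊖₀ null (b-eq h) ⊕₀ X ⊗₀ null (a-suc (suc h))
               ⊖₀ _ ⊗₀ null (g-eq (suc h)) ⊕₀ _ ⊗₀ null (g-eq h))

      -- Both sides solve one recurrence, whose source is `K` times the source at the closed counts;
      -- substituting `g-closed` into the recurrence of b brings it to that form.
      b-closed : ∀ h → K X * b h ≈ b̂ X r (height h) (pow h)
      b-closed = solution-unique
        {s₀ = K X * (ĝ X r (pow 0) ⊖ ⟦ + 1 ⟧ + X * X * ĝ X r (pow 1))}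
        {s = λ h → K X * source X (height h) (ĝ X r (pow h)) (ĝ X r (pow (suc h))) (ĝ X r (pow (suc (suc h))))}
        ( (solve 8 (λ X k b₀ b₁ g₀ g₁ ĝ₀ ĝ₁ → let 1# = con (+ 1) in
              k :* b₀ :- (k :* (ĝ₀ :- 1# :+ X :* X :* ĝ₁) :+ X :* ((1# :+ X) :* (k :* b₁)))
              := k :* ((b₀ :- (g₀ :- 1# :+ X :* X :* g₁ :+ X :* ((1# :+ X) :* b₁)))
                       :+ (g₀ :- ĝ₀) :+ X :* X :* (g₁ :- ĝ₁)))
            refl X (K X) (b 0) (b 1) (g 0) (g 1) (ĝ X r (pow 0)) (ĝ X r (pow 1))
            from K X ⊗₀ (null (proj₁ b-solves) ⊕₀ null (g-closed 0) ⊕₀ X * X ⊗₀ null (g-closed 1)))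
        , (λ h → solve 12 (λ X h k b₀ b₁ b₂ g₀ g₁ g₂ ĝ₀ ĝ₁ ĝ₂ →
              let 1# = con (+ 1); h₁ = 1# :+ h; h₂ = 1# :+ h₁ in
              (1# :+ X) :* (k :* b₁) :-
              (k :* b₀ :+ X :* ((1# :+ X) :* (k :* b₂)) :+ k :* P.source X h ĝ₀ ĝ₁ ĝ₂)
              := k :* (((1# :+ X) :* b₁ :- (b₀ :+ X :* ((1# :+ X) :* b₂) :+ P.source X h g₀ g₁ g₂))
                       :+ h₂ :* (g₁ :- ĝ₁) :- h₁ :* (g₀ :- ĝ₀) :+ X :* X :* (h₂ :* (g₂ :- ĝ₂))))
            refl X (height h) (K X) (b h) (b (suc h)) (b (suc (suc h)))
              (g h) (g (suc h)) (g (suc (suc h)))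
              (ĝ X r (pow h)) (ĝ X r (pow (suc h))) (ĝ X r (pow (suc (suc h))))
            from K X ⊗₀ (null (proj₂ b-solves h) ⊕₀ _ ⊗₀ null (g-closed (suc h)) ⊖₀ _ ⊗₀ null (g-closed h)
                          ⊕₀ X * X ⊗₀ (_ ⊗₀ null (g-closed (suc (suc h)))))))
        (b̂-initial , λ h → b̂-step (height h) (pow h))

      generating-function :
        horner X (+ 0 ∷ + 0 ∷ + 0 ∷ + 0 ∷ -[1+ 1 ] ∷ + 4 ∷ + 6 ∷ []) * b 0 ≈
        horner X (-[1+ 0 ] ∷ + 3 ∷ + 1 ∷ -[1+ 1 ] ∷ []) * S X r
        + horner X (+ 1 ∷ -[1+ 3 ] ∷ + 0 ∷ + 7 ∷ + 2 ∷ [])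
      generating-function = begin
        _                             ≈⟨ *-congʳ gf-denominator ⟩
        _ * K X * b 0               ≈⟨ *-assoc _ _ _ ⟩
        _ * (K X * b 0)             ≈⟨ *-congˡ (b-closed 0) ⟩
        _ * b̂ X r (height 0) (pow 0)  ≈⟨ gf-numerator ⟩
        _                             ∎
        where open import Relation.Binary.Reasoning.Setoid setoid

    -- Solving the recurrence for trinomial coefficients

    module CentralTrinomial
      (only-zero : ∀ (d : ℕ → Carrier) → d 0 ≈ X * (d 0 + ⟦ + 2 ⟧ * d 1) →
        (∀ j → d (suc j) ≈ X * (d j + d (suc j) + d (suc (suc j)))) → ∀ j → Null (d j))
      (t : ℕ → Carrier)
      (t-zero : t 0 ≈ ⟦ + 1 ⟧ + X * (t 0 + ⟦ + 2 ⟧ * t 1))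
      (t-suc  : ∀ j → t (suc j) ≈ X * (t j + t (suc j) + t (suc (suc j))))
      where

      zpow : ℕ → Carrier
      zpow zero    = ⟦ + 1 ⟧
      zpow (suc j) = zpow j * z X r

      St≈zpow : ∀ j → S X r * t j ≈ zpow j
      St≈zpow j = x∙y⁻¹≈ε⇒x≈y _ _ (only-zero (λ j → S X r * t j ⊖ zpow j)
        -- The boundary works because 1 - x(1+2z) equals S identically.
        (solve 4 (λ X r t₀ t₁ → let 1# = con (+ 1); s = P.S X r in
            (s :* t₀ :- 1#) :- X :* ((s :* t₀ :- 1#) :+ con (+ 2) :* (s :* t₁ :- 1# :* P.z X r))
            := s :* (t₀ :- (1# :+ X :* (t₀ :+ con (+ 2) :* t₁))))
          refl X r (t 0) (t 1)
          from S X r ⊗₀ null t-zero)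
        (λ j → solve 6 (λ X r p t₀ t₁ t₂ → let 1# = con (+ 1); s = P.S X r; z = P.z X r in
            (s :* t₁ :- p :* z) :- X :* ((s :* t₀ :- p) :+ (s :* t₁ :- p :* z) :+ (s :* t₂ :- p :* z :* z))
            := s :* (t₁ :- X :* (t₀ :+ t₁ :+ t₂)) :+ p :* (1# :+ X) :* P.κ X r)
          refl X r (zpow j) (t j) (t (suc j)) (t (suc (suc j)))
          from S X r ⊗₀ null (t-suc j) ⊕₀ _ ⊗₀ kernel)
        j)

    -- Eliminating the square root

    module ClosedForm
      (U T Θ : Carrier)
      (gf : horner X (+ 0 ∷ + 0 ∷ + 0 ∷ + 0 ∷ -[1+ 1 ] ∷ + 4 ∷ + 6 ∷ []) * U ≈
            horner X (-[1+ 0 ] ∷ + 3 ∷ + 1 ∷ -[1+ 1 ] ∷ []) * S X r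
            + horner X (+ 1 ∷ -[1+ 3 ] ∷ + 0 ∷ + 7 ∷ + 2 ∷ []))
      (ST≈1 : S X r * T ≈ ⟦ + 1 ⟧)
      (geometric : Θ ≈ ⟦ + 1 ⟧ + X * (⟦ + 3 ⟧ * Θ))
      where

      T²D≈1 : T * T * D X ≈ ⟦ + 1 ⟧
      T²D≈1 = solve 3 (λ t s d → let 1# = con (+ 1) in
          t :* t :* d :- 1# := (s :* t :+ 1#) :* (s :* t :- 1#) :- t :* t :* (s :* s :- d))
        refl T (S X r) (D X)
        from _ ⊗₀ null ST≈1 ⊖₀ _ ⊗₀ null S²≈D

      -- D = (1+x)(1-3x) and Θ = 1/(1-3x), so this is T² = 1/D with one factor cancelled. It makes
      -- two consecutive self-convolutions of the trinomial sequence add up to a power of 3.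
      T²-relation : (⟦ + 1 ⟧ + X) * (T * T) ≈ Θ
      T²-relation = solve 4 (λ X r t θ → let 1# = con (+ 1) in
          (1# :+ X) :* (t :* t) :- θ
          := θ :* (t :* t :* P.D X :- 1#) :- (1# :+ X) :* (t :* t) :* (θ :- (1# :+ X :* (con (+ 3) :* θ))))
        refl X r T Θ
        from Θ ⊗₀ null T²D≈1 ⊖₀ _ ⊗₀ null geometric

      -- Multiplying the difference of both sides by T²D = 1 brings it into the ideal of the hypotheses.
      closed-form :
        X * (X * (X * (X * (⟦ + 2 ⟧ * U)))) ≈
        X * (X * (X * (X * (⟦ + 3 ⟧ * Θ)))) + horner X (+ 1 ∷ -[1+ 2 ] ∷ -[1+ 0 ] ∷ + 2 ∷ []) * T
        ⊖ horner X (+ 1 ∷ -[1+ 1 ] ∷ -[1+ 0 ] ∷ -[1+ 0 ] ∷ [])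
      closed-form = solve 5 (λ X r u t θ →
          let 1# = con (+ 1)
              s  = P.S X r
              d  = P.D X
              n  = P.horner X (-[1+ 0 ] ∷ + 3 ∷ + 1 ∷ -[1+ 1 ] ∷ [])
              lhs = X :* (X :* (X :* (X :* (con (+ 2) :* u))))
              rhs = X :* (X :* (X :* (X :* (con (+ 3) :* θ)))) :+ P.horner X (+ 1 ∷ -[1+ 2 ] ∷ -[1+ 0 ] ∷ + 2 ∷ []) :* t
                    :- P.horner X (+ 1 ∷ -[1+ 1 ] ∷ -[1+ 0 ] ∷ -[1+ 0 ] ∷ [])
          in
          lhs :- rhs
          := t :* t :* (con (+ 3) :* (X :* X :* X :* X) :* (:- (1# :+ X)) :* (θ :- (1# :+ X :* (con (+ 3) :* θ)))
                        :- (P.horner X (+ 0 ∷ + 0 ∷ + 0 ∷ + 0 ∷ -[1+ 1 ] ∷ + 4 ∷ + 6 ∷ []) :* u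
                            :- (n :* s :+ P.horner X (+ 1 ∷ -[1+ 3 ] ∷ + 0 ∷ + 7 ∷ + 2 ∷ [])))
                        :- n :* t :* (s :* s :- d) :+ n :* s :* (s :* t :- 1#))
             :- (lhs :- rhs) :* (t :* t :* d :- 1#))
        refl X r U T Θ
        from T * T ⊗₀ (_ ⊗₀ null geometric ⊖₀ null gf ⊖₀ _ ⊗₀ null S²≈D ⊕₀ _ ⊗₀ null ST≈1) ⊖₀ _ ⊗₀ null T²D≈1

open import Algebra.Consequences.Setoid using (comm∧idˡ⇒id; comm∧distrʳ⇒distr)
import Algebra.Construct.Pointwise as Pointwise
open import Algebra.Structures using (IsAbelianGroup; IsCommutativeRing)
open import Data.Bool using (Bool; true; false; _∧_; not; if_then_else_)
open import Data.Bool.Properties using (∧-assoc; ∧-zeroʳ; ∧-identityʳ)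
open import Data.Nat using (z≤n; s≤s; s≤s⁻¹; _≤ᵇ_; _≡ᵇ_; _≥_; _^_)
import Data.Nat as ℕ
open import Data.Nat.Combinatorics using (_C_; nCk+nC[k+1]≡[n+1]C[k+1]; k>n⇒nCk≡0)
open import Data.Nat.ListAction using (sum)
open import Data.Nat.ListAction.Properties using (sum-++)
import Data.Nat.Properties as ℕ
import Data.Nat.Solver as ℕ
open import Data.Product using (Σ; ∃)
open import Data.Sum using (inj₁; inj₂)
open import Data.Integer using (-_; _+_; _*_; _-_; _<_; ∣_∣)
open import Data.Integer.Solver using (module +-*-Solver)
open import Data.List using (_++_; map; upTo; applyUpTo; concatMap; filterᵇ)
open import Data.List.Properties using (map-++; map-∘; map-cong; map-applyUpTo)
open import Function using (_∘_; id)
open import Relation.Binary.PropositionalEquality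
  using (_≡_; _≗_; refl; sym; trans; cong; cong₂; subst; module ≡-Reasoning)
open import Relation.Nullary.Decidable using (yes; no; dec-true; dec-false)
open import Relation.Nullary.Negation using (contradiction)

-- The ring of power series

infixl 7 _·_
infix  4 _≐_

_≐_ : PS → PS → Set
_≐_ = _≗_

_·_ : ℤ → PS → PS
(c · f) n = c * f n

tail : PS → PS
tail f n = f (suc n)

infixl 6 _⊞_
_⊞_ : PS → PS → PS
(f ⊞ g) n = f n + g n

⊟_ : PS → PS
(⊟ f) n = - f n

⊛-zero : ∀ f g → (f ⊛ g) 0 ≡ f 0 * g 0
⊛-zero f g = ℤ.+-identityʳ _

-- Recursion on the left factor replaces all index manipulation: the ring laws follow from it by
-- induction on the coefficient.
⊛-suc : ∀ f g n → (f ⊛ g) (suc n) ≡ f 0 * g (suc n) + (tail f ⊛ g) n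
⊛-suc f g n = cong (λ l → f 0 * g (suc n) + sumℤ l)
  (trans (map-applyUpTo suc (λ i → f i * g (suc n ℕ.∸ i)) (suc n))
         (sym (map-applyUpTo id (λ i → f (suc i) * g (n ℕ.∸ i)) (suc n))))

⊛-local : ∀ n {f f′ g g′} → (∀ {i} → i ℕ.≤ n → f i ≡ f′ i) → (∀ {i} → i ℕ.≤ n → g i ≡ g′ i) →
          (f ⊛ g) n ≡ (f′ ⊛ g′) n
⊛-local zero {f} {f′} {g} {g′} f≈ g≈ =
  trans (⊛-zero f g) (trans (cong₂ _*_ (f≈ z≤n) (g≈ z≤n)) (sym (⊛-zero f′ g′)))
⊛-local (suc n) {f} {f′} {g} {g′} f≈ g≈ = begin
  (f ⊛ g) (suc n)                       ≡⟨ ⊛-suc f g n ⟩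
  f 0 * g (suc n) + (tail f ⊛ g) n      ≡⟨ cong₂ _+_ (cong₂ _*_ (f≈ z≤n) (g≈ ℕ.≤-refl))
                                             (⊛-local n (f≈ ∘ s≤s) (g≈ ∘ ℕ.m≤n⇒m≤1+n)) ⟩
  f′ 0 * g′ (suc n) + (tail f′ ⊛ g′) n  ≡⟨ ⊛-suc f′ g′ n ⟨
  (f′ ⊛ g′) (suc n)                     ∎
  where open ≡-Reasoning

⊛-cong : ∀ {f f′ g g′} → f ≐ f′ → g ≐ g′ → f ⊛ g ≐ f′ ⊛ g′
⊛-cong f≈ g≈ n = ⊛-local n (λ {i} _ → f≈ i) (λ {i} _ → g≈ i)

⊛-congˡ : ∀ {f f′} g → f ≐ f′ → f ⊛ g ≐ f′ ⊛ g
⊛-congˡ g f≈ = ⊛-cong {g = g} f≈ (λ _ → refl)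

-- The mirror image of `⊛-suc`; commutativity exchanges the two recursions.
⊛-sucʳ : ∀ f g n → (f ⊛ g) (suc n) ≡ f (suc n) * g 0 + (f ⊛ tail g) n
⊛-sucʳ f g zero = begin
  (f ⊛ g) 1                      ≡⟨ ⊛-suc f g 0 ⟩
  f 0 * g 1 + (tail f ⊛ g) 0     ≡⟨ cong (λ t → f 0 * g 1 + t) (⊛-zero (tail f) g) ⟩
  f 0 * g 1 + f 1 * g 0          ≡⟨ ℤ.+-comm (f 0 * g 1) _ ⟩
  f 1 * g 0 + f 0 * g 1          ≡⟨ cong (_+_ (f 1 * g 0)) (⊛-zero f (tail g)) ⟨
  f 1 * g 0 + (f ⊛ tail g) 0     ∎
  where open ≡-Reasoning
⊛-sucʳ f g (suc n) = begin
  (f ⊛ g) (suc (suc n))                                       ≡⟨ ⊛-suc f g (suc n) ⟩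
  f 0 * g₂ + (tail f ⊛ g) (suc n)                             ≡⟨ cong (_+_ (f 0 * g₂)) (⊛-sucʳ (tail f) g n) ⟩
  f 0 * g₂ + (f₂ * g 0 + (tail f ⊛ tail g) n)                 ≡⟨ solve 3 (λ a b c → a :+ (b :+ c) := b :+ (a :+ c)) refl
                                                                  (f 0 * g₂) (f₂ * g 0) ((tail f ⊛ tail g) n) ⟩
  f₂ * g 0 + (f 0 * g₂ + (tail f ⊛ tail g) n)                 ≡⟨ cong (_+_ (f₂ * g 0)) (⊛-suc f (tail g) n) ⟨
  f₂ * g 0 + (f ⊛ tail g) (suc n)                             ∎
  where
  open ≡-Reasoning
  open +-*-Solver
  f₂ = f (suc (suc n))
  g₂ = g (suc (suc n))

⊛-comm : ∀ f g → f ⊛ g ≐ g ⊛ f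
⊛-comm f g zero    = trans (⊛-zero f g) (trans (ℤ.*-comm (f 0) (g 0)) (sym (⊛-zero g f)))
⊛-comm f g (suc n) = begin
  (f ⊛ g) (suc n)                   ≡⟨ ⊛-suc f g n ⟩
  f 0 * g (suc n) + (tail f ⊛ g) n  ≡⟨ cong₂ _+_ (ℤ.*-comm (f 0) (g (suc n))) (⊛-comm (tail f) g n) ⟩
  g (suc n) * f 0 + (g ⊛ tail f) n  ≡⟨ ⊛-sucʳ g f n ⟨
  (g ⊛ f) (suc n)                   ∎
  where open ≡-Reasoning

⊛-distribʳ-⊞ : ∀ h f g → (f ⊞ g) ⊛ h ≐ (f ⊛ h) ⊞ (g ⊛ h)
⊛-distribʳ-⊞ h f g zero = begin
  ((f ⊞ g) ⊛ h) 0             ≡⟨ ⊛-zero (f ⊞ g) h ⟩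
  (f 0 + g 0) * h 0           ≡⟨ ℤ.*-distribʳ-+ (h 0) (f 0) (g 0) ⟩
  f 0 * h 0 + g 0 * h 0       ≡⟨ cong₂ _+_ (⊛-zero f h) (⊛-zero g h) ⟨
  ((f ⊛ h) ⊞ (g ⊛ h)) 0       ∎
  where open ≡-Reasoning
⊛-distribʳ-⊞ h f g (suc n) = begin
  ((f ⊞ g) ⊛ h) (suc n)                                          ≡⟨ ⊛-suc (f ⊞ g) h n ⟩
  (f 0 + g 0) * h₁ + ((tail f ⊞ tail g) ⊛ h) n                   ≡⟨ cong (_+_ ((f 0 + g 0) * h₁)) (⊛-distribʳ-⊞ h (tail f) (tail g) n) ⟩
  (f 0 + g 0) * h₁ + ((tail f ⊛ h) n + (tail g ⊛ h) n)           ≡⟨ solve 5 (λ a b c d e → (a :+ b) :* c :+ (d :+ e) := (a :* c :+ d) :+ (b :* c :+ e))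
                                                                      refl (f 0) (g 0) h₁ ((tail f ⊛ h) n) ((tail g ⊛ h) n) ⟩
  (f 0 * h₁ + (tail f ⊛ h) n) + (g 0 * h₁ + (tail g ⊛ h) n)      ≡⟨ cong₂ _+_ (⊛-suc f h n) (⊛-suc g h n) ⟨
  ((f ⊛ h) ⊞ (g ⊛ h)) (suc n)                                    ∎
  where
  open ≡-Reasoning
  open +-*-Solver
  h₁ = h (suc n)

·-⊛-assoc : ∀ c f g → (c · f) ⊛ g ≐ c · (f ⊛ g)
·-⊛-assoc c f g zero = begin
  ((c · f) ⊛ g) 0     ≡⟨ ⊛-zero (c · f) g ⟩
  c * f 0 * g 0       ≡⟨ ℤ.*-assoc c (f 0) (g 0) ⟩
  c * (f 0 * g 0)     ≡⟨ cong (c *_) (⊛-zero f g) ⟨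
  c * (f ⊛ g) 0       ∎
  where open ≡-Reasoning
·-⊛-assoc c f g (suc n) = begin
  ((c · f) ⊛ g) (suc n)                           ≡⟨ ⊛-suc (c · f) g n ⟩
  c * f 0 * g (suc n) + ((c · tail f) ⊛ g) n      ≡⟨ cong (_+_ (c * f 0 * g (suc n))) (·-⊛-assoc c (tail f) g n) ⟩
  c * f 0 * g (suc n) + c * (tail f ⊛ g) n        ≡⟨ solve 4 (λ c a b d → c :* a :* b :+ c :* d := c :* (a :* b :+ d))
                                                       refl c (f 0) (g (suc n)) ((tail f ⊛ g) n) ⟩
  c * (f 0 * g (suc n) + (tail f ⊛ g) n)          ≡⟨ cong (c *_) (⊛-suc f g n) ⟨
  c * (f ⊛ g) (suc n)                             ∎
  where
  open ≡-Reasoning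
  open +-*-Solver

-- By `⊛-suc` the tail of f ⊛ g is itself a sum, f 0 · tail g plus tail f ⊛ g, so distributivity and
-- the scalar case reduce the step to the induction hypothesis for `tail f`.
⊛-assoc : ∀ f g h → (f ⊛ g) ⊛ h ≐ f ⊛ (g ⊛ h)
⊛-assoc f g h zero = begin
  ((f ⊛ g) ⊛ h) 0       ≡⟨ trans (⊛-zero (f ⊛ g) h) (cong (_* h 0) (⊛-zero f g)) ⟩
  f 0 * g 0 * h 0       ≡⟨ ℤ.*-assoc (f 0) (g 0) (h 0) ⟩
  f 0 * (g 0 * h 0)     ≡⟨ trans (⊛-zero f (g ⊛ h)) (cong (f 0 *_) (⊛-zero g h)) ⟨
  (f ⊛ (g ⊛ h)) 0       ∎
  where open ≡-Reasoning
⊛-assoc f g h (suc n) = begin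
  ((f ⊛ g) ⊛ h) (suc n)                                                  ≡⟨ ⊛-suc (f ⊛ g) h n ⟩
  (f ⊛ g) 0 * h₁ + (tail (f ⊛ g) ⊛ h) n                                  ≡⟨ cong₂ _+_ (cong (_* h₁) (⊛-zero f g))
                                                                             (⊛-congˡ h (⊛-suc f g) n) ⟩
  f 0 * g 0 * h₁ + (((f 0 · tail g) ⊞ (tail f ⊛ g)) ⊛ h) n               ≡⟨ cong (_+_ (f 0 * g 0 * h₁))
                                                                             (⊛-distribʳ-⊞ h (f 0 · tail g) (tail f ⊛ g) n) ⟩
  f 0 * g 0 * h₁ + (((f 0 · tail g) ⊛ h) n + ((tail f ⊛ g) ⊛ h) n)       ≡⟨ cong (_+_ (f 0 * g 0 * h₁))
                                                                             (cong₂ _+_ (·-⊛-assoc (f 0) (tail g) h n) (⊛-assoc (tail f) g h n)) ⟩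
  f 0 * g 0 * h₁ + (f 0 * (tail g ⊛ h) n + (tail f ⊛ (g ⊛ h)) n)         ≡⟨ solve 5 (λ a b c d e → a :* b :* c :+ (a :* d :+ e) := a :* (b :* c :+ d) :+ e)
                                                                             refl (f 0) (g 0) h₁ ((tail g ⊛ h) n) ((tail f ⊛ (g ⊛ h)) n) ⟩
  f 0 * (g 0 * h₁ + (tail g ⊛ h) n) + (tail f ⊛ (g ⊛ h)) n               ≡⟨ cong (λ t → f 0 * t + (tail f ⊛ (g ⊛ h)) n) (⊛-suc g h n) ⟨
  f 0 * (g ⊛ h) (suc n) + (tail f ⊛ (g ⊛ h)) n                           ≡⟨ ⊛-suc f (g ⊛ h) n ⟨
  (f ⊛ (g ⊛ h)) (suc n)                                                  ∎
  where
  open ≡-Reasoning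
  open +-*-Solver
  h₁ = h (suc n)

const : ℤ → PS
const c = poly (c ∷ [])

X : PS
X = poly (+ 0 ∷ + 1 ∷ [])

0⊛ : ∀ f → (λ _ → + 0) ⊛ f ≐ (λ _ → + 0)
0⊛ f zero    = refl
0⊛ f (suc n) = trans (⊛-suc (λ _ → + 0) f n) (trans (ℤ.+-identityˡ _) (0⊛ f n))

const-⊛ : ∀ c f → const c ⊛ f ≐ c · f
const-⊛ c f zero    = ⊛-zero (const c) f
const-⊛ c f (suc n) = trans (⊛-suc (const c) f n)
  (trans (cong (_+_ (c * f (suc n))) (0⊛ f n)) (ℤ.+-identityʳ _))

1⊛ : ∀ f → const (+ 1) ⊛ f ≐ f
1⊛ f n = trans (const-⊛ (+ 1) f n) (ℤ.*-identityˡ (f n))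

X⊛-zero : ∀ f → (X ⊛ f) 0 ≡ + 0
X⊛-zero f = ⊛-zero X f

X⊛-suc : ∀ f n → (X ⊛ f) (suc n) ≡ f n
X⊛-suc f n = trans (⊛-suc X f n) (trans (ℤ.+-identityˡ _)
  (trans (⊛-congˡ {tail X} {const (+ 1)} f (λ { zero → refl ; (suc _) → refl }) n) (1⊛ f n)))

PS-isCommutativeRing : IsCommutativeRing _≐_ _⊞_ _⊛_ ⊟_ (λ _ → + 0) (const (+ 1))
PS-isCommutativeRing = record
  { isRing = record
    { +-isAbelianGroup = +-isAbelianGroup
    ; *-cong           = ⊛-cong
    ; *-assoc          = ⊛-assoc
    ; *-identity       = comm∧idˡ⇒id setoid ⊛-comm 1⊛
    ; distrib          = comm∧distrʳ⇒distr setoid ∙-cong ⊛-comm ⊛-distribʳ-⊞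
    }
  ; *-comm = ⊛-comm
  }
  where
  +-isAbelianGroup = Pointwise.isAbelianGroup ℕ ℤ.+-0-isAbelianGroup
  open IsAbelianGroup +-isAbelianGroup using (setoid; ∙-cong)

PS-commutativeRing : CommutativeRing _ _
PS-commutativeRing = record { isCommutativeRing = PS-isCommutativeRing }

-- Continuations of Catalan words

∑ : ℕ → (ℕ → ℕ) → ℕ
∑ zero    φ = 0
∑ (suc n) φ = φ 0 ℕ.+ ∑ n (φ ∘ suc)

∑-cong : ∀ n {φ ψ} → (∀ {i} → i ℕ.< n → φ i ≡ ψ i) → ∑ n φ ≡ ∑ n ψ
∑-cong zero    φ≈ψ = refl
∑-cong (suc n) φ≈ψ = cong₂ ℕ._+_ (φ≈ψ (s≤s z≤n)) (∑-cong n (φ≈ψ ∘ s≤s))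

∑-zero : ∀ n {φ} → (∀ i → φ i ≡ 0) → ∑ n φ ≡ 0
∑-zero zero    φ≈0 = refl
∑-zero (suc n) φ≈0 = cong₂ ℕ._+_ (φ≈0 0) (∑-zero n (φ≈0 ∘ suc))

∑-suc : ∀ n φ → ∑ (suc n) φ ≡ ∑ n φ ℕ.+ φ n
∑-suc zero    φ = ℕ.+-comm (φ 0) 0
∑-suc (suc n) φ = trans (cong (φ 0 ℕ.+_) (∑-suc n (φ ∘ suc))) (sym (ℕ.+-assoc (φ 0) _ _))

∑-+ : ∀ n φ ψ → ∑ n (λ i → φ i ℕ.+ ψ i) ≡ ∑ n φ ℕ.+ ∑ n ψ
∑-+ zero    φ ψ = refl
∑-+ (suc n) φ ψ = trans (cong (φ 0 ℕ.+ ψ 0 ℕ.+_) (∑-+ n (φ ∘ suc) (ψ ∘ suc)))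
  (solve 4 (λ a b c d → a :+ b :+ (c :+ d) := (a :+ c) :+ (b :+ d)) refl (φ 0) (ψ 0) _ _)
  where open ℕ.+-*-Solver

∑-* : ∀ n c φ → ∑ n (λ i → c ℕ.* φ i) ≡ c ℕ.* ∑ n φ
∑-* zero    c φ = sym (ℕ.*-zeroʳ c)
∑-* (suc n) c φ = trans (cong (c ℕ.* φ 0 ℕ.+_) (∑-* n c (φ ∘ suc))) (sym (ℕ.*-distribˡ-+ c (φ 0) _))

∑-truncate : ∀ {k n} φ → k ℕ.≤ n → (∀ {i} → k ℕ.≤ i → φ i ≡ 0) → ∑ n φ ≡ ∑ k φ
∑-truncate {n = n} φ z≤n       φ≈0 = ∑-zero n (λ _ → φ≈0 z≤n)
∑-truncate         φ (s≤s k≤n) φ≈0 = cong (φ 0 ℕ.+_) (∑-truncate (φ ∘ suc) k≤n (φ≈0 ∘ s≤s))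

sum-map-applyUpTo : ∀ φ (ψ : ℕ → ℕ) n → sum (map φ (applyUpTo ψ n)) ≡ ∑ n (φ ∘ ψ)
sum-map-applyUpTo φ ψ zero    = refl
sum-map-applyUpTo φ ψ (suc n) = cong (φ (ψ 0) ℕ.+_) (sum-map-applyUpTo φ (ψ ∘ suc) n)

sum-map-concatMap : ∀ {A : Set} (φ : A → ℕ) (ψ : ℕ → List A) xs →
                    sum (map φ (concatMap ψ xs)) ≡ sum (map (λ x → sum (map φ (ψ x))) xs)
sum-map-concatMap φ ψ []       = refl
sum-map-concatMap φ ψ (x ∷ xs) = begin
  sum (map φ (ψ x ++ concatMap ψ xs))                        ≡⟨ cong sum (map-++ φ (ψ x) _) ⟩
  sum (map φ (ψ x) ++ map φ (concatMap ψ xs))                ≡⟨ sum-++ (map φ (ψ x)) _ ⟩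
  sum (map φ (ψ x)) ℕ.+ sum (map φ (concatMap ψ xs))         ≡⟨ cong (sum (map φ (ψ x)) ℕ.+_) (sum-map-concatMap φ ψ xs) ⟩
  _                                                          ∎
  where open ≡-Reasoning

sum-map-filterᵇ : ∀ {A : Set} (φ : A → ℕ) p xs →
                  sum (map φ (filterᵇ p xs)) ≡ sum (map (λ x → if p x then φ x else 0) xs)
sum-map-filterᵇ φ p []       = refl
sum-map-filterᵇ φ p (x ∷ xs) with p x
... | true  = cong (φ x ℕ.+_) (sum-map-filterᵇ φ p xs)
... | false = sum-map-filterᵇ φ p xs

sum-allSeqs-suc : ∀ φ n m → sum (map φ (allSeqs (suc n) m)) ≡ ∑ m (λ x → sum (map (φ ∘ (x ∷_)) (allSeqs n m)))
sum-allSeqs-suc φ n m = begin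
  sum (map φ (allSeqs (suc n) m))                                        ≡⟨ sum-map-concatMap φ _ (upTo m) ⟩
  sum (map (λ x → sum (map φ (map (x ∷_) (allSeqs n m)))) (upTo m))      ≡⟨ cong sum (map-cong (λ x → cong sum (sym (map-∘ (allSeqs n m)))) (upTo m)) ⟩
  sum (map (λ x → sum (map (φ ∘ (x ∷_)) (allSeqs n m))) (upTo m))        ≡⟨ sum-map-applyUpTo _ id m ⟩
  ∑ m (λ x → sum (map (φ ∘ (x ∷_)) (allSeqs n m)))                       ∎
  where open ≡-Reasoning

-- p is the last letter read; d records whether it was a weak descent.
continues : ℕ → Bool → List ℕ → Bool
continues p d []       = true
continues p d (y ∷ ys) = ((y ≤ᵇ suc p) ∧ not (d ∧ (y ≤ᵇ p))) ∧ continues y (y ≤ᵇ p) ys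

∧-swap : ∀ a b c d → (a ∧ b) ∧ (c ∧ d) ≡ (a ∧ c) ∧ (b ∧ d)
∧-swap true  b true  d = refl
∧-swap true  b false d = ∧-zeroʳ b
∧-swap false b c     d = refl

continues-correct₂ : ∀ a p ys → (steps p ys ∧ avoidsGeGe (a ∷ p ∷ ys)) ≡ continues p (p ≤ᵇ a) ys
continues-correct₂ a p []       = refl
continues-correct₂ a p (y ∷ ys) =
  trans (∧-swap (y ≤ᵇ suc p) _ _ _)
        (cong (((y ≤ᵇ suc p) ∧ not ((p ≤ᵇ a) ∧ (y ≤ᵇ p))) ∧_) (continues-correct₂ p y ys))

continues-correct₁ : ∀ p ys → (steps p ys ∧ avoidsGeGe (p ∷ ys)) ≡ continues p false ys
continues-correct₁ p []       = refl
continues-correct₁ p (y ∷ ys) =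
  trans (∧-assoc (y ≤ᵇ suc p) _ _)
  (trans (cong ((y ≤ᵇ suc p) ∧_) (continues-correct₂ p y ys))
         (cong (_∧ continues y (y ≤ᵇ p) ys) (sym (∧-identityʳ (y ≤ᵇ suc p)))))

-- h is one more than the last letter. The sequences fˢ, aˢ (resp. gˢ, bˢ) count and add up the
-- areas of the continuations of length n after an ascent (resp. after a weak descent).
mutual
  fˢ gˢ aˢ bˢ : ℕ → ℕ → ℕ
  fˢ h zero    = 1
  fˢ h (suc n) = gˢ h (suc n) ℕ.+ ∑ h (λ j → gˢ (suc j) n)
  gˢ h zero    = 1
  gˢ h (suc n) = fˢ (suc h) n
  aˢ h zero    = 0
  aˢ h (suc n) = bˢ h (suc n) ℕ.+ ∑ h (λ j → suc j ℕ.* gˢ (suc j) n ℕ.+ bˢ (suc j) n)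
  bˢ h zero    = 0
  bˢ h (suc n) = suc h ℕ.* fˢ (suc h) n ℕ.+ aˢ (suc h) n

≤⇒≤ᵇ≡true : ∀ {m n} → m ℕ.≤ n → (m ≤ᵇ n) ≡ true
≤⇒≤ᵇ≡true {m} {n} = dec-true (m ℕ.≤? n)

>⇒≤ᵇ≡false : ∀ {m n} → n ℕ.< m → (m ≤ᵇ n) ≡ false
>⇒≤ᵇ≡false {m} {n} n<m = dec-false (m ℕ.≤? n) (ℕ.<⇒≱ n<m)

module _ (m : ℕ) where

  -- The argument s is the area accumulated before the continuation, and m bounds the alphabet that
  -- is enumerated.
  total : ℕ → Bool → ℕ → ℕ → ℕ
  total p d s n = sum (map (λ ys → if continues p d ys then s ℕ.+ area ys else 0) (allSeqs n m))

  sum-zeros : ∀ (yss : List (List ℕ)) → sum (map (λ _ → 0) yss) ≡ 0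
  sum-zeros []         = refl
  sum-zeros (_ ∷ yss)  = sum-zeros yss

  sum-first : ∀ c y d s n →
    sum (map (λ ys → if c ∧ continues y d ys then s ℕ.+ area (y ∷ ys) else 0) (allSeqs n m)) ≡
    (if c then total y d (s ℕ.+ suc y) n else 0)
  sum-first false y d s n = sum-zeros (allSeqs n m)
  sum-first true  y d s n = cong sum (map-cong
    (λ ys → cong (if continues y d ys then_else 0) (sym (ℕ.+-assoc s (suc y) (area ys)))) (allSeqs n m))

  allowed : Bool → ℕ → ℕ → Bool
  allowed d p y = (y ≤ᵇ suc p) ∧ not (d ∧ (y ≤ᵇ p))

  -- A word ending in p reaches at most p + suc n in `suc n` further letters, so the hypothesis
  -- keeps every admissible continuation inside the alphabet. The next letter is either p+1, the
  -- only ascent, or one of the p+1 letters up to p, allowed only if the previous step was no weak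
  -- descent.
  total-suc : ∀ p d s n → p ℕ.+ suc n ℕ.< m →
    total p d s (suc n) ≡
    total (suc p) false (s ℕ.+ suc (suc p)) n ℕ.+
    ∑ (suc p) (λ y → if not d then total y true (s ℕ.+ suc y) n else 0)
  total-suc p d s n p+1+n<m = begin
    total p d s (suc n)                        ≡⟨ sum-allSeqs-suc _ n m ⟩
    _                                          ≡⟨ ∑-cong m (λ {y} _ → sum-first (allowed d p y) y (y ≤ᵇ p) s n) ⟩
    ∑ m ψ                                      ≡⟨ ∑-truncate ψ 2+p≤m too-large ⟩
    ∑ (suc (suc p)) ψ                          ≡⟨ ∑-suc (suc p) ψ ⟩
    ∑ (suc p) ψ ℕ.+ ψ (suc p)                  ≡⟨ ℕ.+-comm (∑ (suc p) ψ) _ ⟩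
    ψ (suc p) ℕ.+ ∑ (suc p) ψ                  ≡⟨ cong₂ ℕ._+_ ascent (∑-cong (suc p) (descent ∘ s≤s⁻¹)) ⟩
    _                                          ∎
    where
    open ≡-Reasoning
    ψ : ℕ → ℕ
    ψ y = if allowed d p y then total y (y ≤ᵇ p) (s ℕ.+ suc y) n else 0
    2+p≤m : suc (suc p) ℕ.≤ m
    2+p≤m = ℕ.≤-trans (s≤s (ℕ.≤-trans (s≤s (ℕ.m≤m+n p n)) (ℕ.≤-reflexive (sym (ℕ.+-suc p n))))) p+1+n<m
    too-large : ∀ {y} → suc (suc p) ℕ.≤ y → ψ y ≡ 0
    too-large {y} p+2≤y rewrite >⇒≤ᵇ≡false {y} {suc p} p+2≤y = refl
    ascent : ψ (suc p) ≡ total (suc p) false (s ℕ.+ suc (suc p)) n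
    ascent rewrite ≤⇒≤ᵇ≡true (ℕ.≤-refl {suc p}) | >⇒≤ᵇ≡false (ℕ.n<1+n p) | ∧-zeroʳ d = refl
    descent : ∀ {y} → y ℕ.≤ p → ψ y ≡ (if not d then total y true (s ℕ.+ suc y) n else 0)
    descent {y} y≤p rewrite ≤⇒≤ᵇ≡true (ℕ.m≤n⇒m≤1+n y≤p) | ≤⇒≤ᵇ≡true y≤p | ∧-identityʳ d = refl

  mutual
    -- The total is affine in the accumulated area s: each continuation contributes s once, besides
    -- its own area.
    total-ascent : ∀ n p s → p ℕ.+ n ℕ.< m → total p false s n ≡ s ℕ.* fˢ (suc p) n ℕ.+ aˢ (suc p) n
    total-ascent zero    p s _       = solve 1 (λ s → s :+ con 0 :+ con 0 := s :* con 1 :+ con 0) refl s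
      where open ℕ.+-*-Solver
    total-ascent (suc n) p s p+1+n<m = begin
      total p false s (suc n)
        ≡⟨ total-suc p false s n p+1+n<m ⟩
      total (suc p) false (s ℕ.+ suc h) n ℕ.+ ∑ h (λ y → total y true (s ℕ.+ suc y) n)
        ≡⟨ cong₂ ℕ._+_ (total-ascent n (suc p) (s ℕ.+ suc h) (p+n<m ℕ.≤-refl))
             (∑-cong h (λ {y} y<h → total-descent n y (s ℕ.+ suc y) (p+n<m (ℕ.<⇒≤ y<h)))) ⟩
      (s ℕ.+ suc h) ℕ.* F ℕ.+ A ℕ.+ ∑ h (λ y → (s ℕ.+ suc y) ℕ.* gˢ (suc y) n ℕ.+ bˢ (suc y) n)
        ≡⟨ cong ((s ℕ.+ suc h) ℕ.* F ℕ.+ A ℕ.+_) (∑-cong h (λ {y} _ →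
             solve 4 (λ s y g b → (s :+ y) :* g :+ b := s :* g :+ (y :* g :+ b)) refl s (suc y) (gˢ (suc y) n) (bˢ (suc y) n))) ⟩
      (s ℕ.+ suc h) ℕ.* F ℕ.+ A ℕ.+ ∑ h (λ y → s ℕ.* G y ℕ.+ B y)
        ≡⟨ cong ((s ℕ.+ suc h) ℕ.* F ℕ.+ A ℕ.+_) (trans (∑-+ h (λ y → s ℕ.* G y) B) (cong (ℕ._+ ∑ h B) (∑-* h s G))) ⟩
      (s ℕ.+ suc h) ℕ.* F ℕ.+ A ℕ.+ (s ℕ.* ∑ h G ℕ.+ ∑ h B)
        ≡⟨ solve 6 (λ s k F A g b → (s :+ k) :* F :+ A :+ (s :* g :+ b) := s :* (F :+ g) :+ (k :* F :+ A :+ b))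
             refl s (suc h) F A (∑ h G) (∑ h B) ⟩
      s ℕ.* (F ℕ.+ ∑ h G) ℕ.+ (suc h ℕ.* F ℕ.+ A ℕ.+ ∑ h B)
        ∎
      where
      open ≡-Reasoning
      open ℕ.+-*-Solver
      h F A : ℕ
      h = suc p
      F = fˢ (suc h) n
      A = aˢ (suc h) n
      G B : ℕ → ℕ
      G y = gˢ (suc y) n
      B y = suc y ℕ.* gˢ (suc y) n ℕ.+ bˢ (suc y) n
      p+n<m : ∀ {y} → y ℕ.≤ suc p → y ℕ.+ n ℕ.< m
      p+n<m y≤ = ℕ.≤-trans (s≤s (ℕ.≤-trans (ℕ.+-monoˡ-≤ n y≤) (ℕ.≤-reflexive (sym (ℕ.+-suc p n))))) p+1+n<m

    total-descent : ∀ n p s → p ℕ.+ n ℕ.< m → total p true s n ≡ s ℕ.* gˢ (suc p) n ℕ.+ bˢ (suc p) n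
    total-descent zero    p s _       = solve 1 (λ s → s :+ con 0 :+ con 0 := s :* con 1 :+ con 0) refl s
      where open ℕ.+-*-Solver
    total-descent (suc n) p s p+1+n<m = begin
      total p true s (suc n)
        ≡⟨ total-suc p true s n p+1+n<m ⟩
      total (suc p) false (s ℕ.+ suc h) n ℕ.+ ∑ h (λ _ → 0)
        ≡⟨ cong₂ ℕ._+_ (total-ascent n (suc p) (s ℕ.+ suc h)
             (ℕ.≤-trans (s≤s (ℕ.≤-reflexive (sym (ℕ.+-suc p n)))) p+1+n<m)) (∑-zero h (λ _ → refl)) ⟩
      (s ℕ.+ suc h) ℕ.* F ℕ.+ A ℕ.+ 0
        ≡⟨ solve 4 (λ s k F A → (s :+ k) :* F :+ A :+ con 0 := s :* F :+ (k :* F :+ A)) refl s (suc h) F A ⟩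
      s ℕ.* F ℕ.+ (suc h ℕ.* F ℕ.+ A)
        ∎
      where
      open ≡-Reasoning
      open ℕ.+-*-Solver
      h F A : ℕ
      h = suc p
      F = fˢ (suc h) n
      A = aˢ (suc h) n

-- Height 0 stands for a virtual letter -1 before the word. The condition that the first letter is 0
-- then becomes a forced ascent, which is what `bˢ 0` prescribes.
u≡bˢ : ∀ n → u n ≡ bˢ 0 n
u≡bˢ zero    = refl
u≡bˢ (suc n) = begin
  u (suc n)                              ≡⟨ sum-map-filterᵇ area _ (allSeqs (suc n) (suc n)) ⟩
  _                                      ≡⟨ sum-allSeqs-suc _ n (suc n) ⟩
  _                                      ≡⟨ ∑-cong (suc n) (λ {x} _ → trans
                                              (cong sum (map-cong (λ ys → cong (if_then area (x ∷ ys) else 0) (starts x ys)) (allSeqs n (suc n))))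
                                              (sum-first (suc n) (x ≡ᵇ 0) x false 0 n)) ⟩
  total (suc n) 0 false 1 n ℕ.+ ∑ n (λ _ → 0)
                                         ≡⟨ cong₂ ℕ._+_ (total-ascent (suc n) n 0 1 ℕ.≤-refl) (∑-zero n (λ _ → refl)) ⟩
  1 ℕ.* fˢ 1 n ℕ.+ aˢ 1 n ℕ.+ 0          ≡⟨ ℕ.+-identityʳ _ ⟩
  bˢ 0 (suc n)                           ∎
  where
  open ≡-Reasoning
  starts : ∀ x ys → (((x ≡ᵇ 0) ∧ steps x ys) ∧ avoidsGeGe (x ∷ ys)) ≡ (x ≡ᵇ 0) ∧ continues x false ys
  starts x ys = trans (∧-assoc (x ≡ᵇ 0) _ _) (cong ((x ≡ᵇ 0) ∧_) (continues-correct₁ x ys))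

-- Differencing in h collapses the sum over weak descents to its last term. Terms are moved across
-- the equation to avoid subtraction in ℕ.
fˢ-suc : ∀ h n → fˢ (suc h) (suc n) ℕ.+ gˢ h (suc n) ≡ fˢ h (suc n) ℕ.+ gˢ (suc h) (suc n) ℕ.+ gˢ (suc h) n
fˢ-suc h n = trans (cong (λ t → gˢ (suc h) (suc n) ℕ.+ t ℕ.+ gˢ h (suc n)) (∑-suc h (λ j → gˢ (suc j) n)))
  (solve 4 (λ a b c d → a :+ (b :+ c) :+ d := d :+ b :+ a :+ c) refl
    (gˢ (suc h) (suc n)) (∑ h (λ j → gˢ (suc j) n)) (gˢ (suc h) n) (gˢ h (suc n)))
  where open ℕ.+-*-Solver

aˢ-suc : ∀ h n → aˢ (suc h) (suc n) ℕ.+ bˢ h (suc n) ≡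
                 aˢ h (suc n) ℕ.+ bˢ (suc h) (suc n) ℕ.+ (suc h ℕ.* gˢ (suc h) n ℕ.+ bˢ (suc h) n)
aˢ-suc h n = trans (cong (λ t → bˢ (suc h) (suc n) ℕ.+ t ℕ.+ bˢ h (suc n)) (∑-suc h φ))
  (solve 4 (λ a b c d → a :+ (b :+ c) :+ d := d :+ b :+ a :+ c) refl
    (bˢ (suc h) (suc n)) (∑ h φ) (φ h) (bˢ h (suc n)))
  where
  open ℕ.+-*-Solver
  φ : ℕ → ℕ
  φ j = suc j ℕ.* gˢ (suc j) n ℕ.+ bˢ (suc j) n

-- Trinomial coefficients

-- The multinomial coefficient n!/(k! l! (n-k-l)!), which is zero when k + l > n.
trinomial : ℕ → ℕ → ℕ → ℕ
trinomial n k l = (n C k) ℕ.* ((n ℕ.∸ k) C l)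

trinomial-zeroˡ : ∀ n l → trinomial n 0 l ≡ n C l
trinomial-zeroˡ n l = ℕ.*-identityˡ (n C l)

trinomial-zeroʳ : ∀ n k → trinomial n k 0 ≡ n C k
trinomial-zeroʳ n k = ℕ.*-identityʳ (n C k)

pascal : ∀ n k → suc n C suc k ≡ n C k ℕ.+ n C suc k
pascal n k = sym (nCk+nC[k+1]≡[n+1]C[k+1] n k)

trinomial-pascal : ∀ n k l → trinomial (suc n) (suc k) (suc l) ≡
  trinomial n k (suc l) ℕ.+ trinomial n (suc k) l ℕ.+ trinomial n (suc k) (suc l)
trinomial-pascal n k l = begin
  (suc n C suc k) ℕ.* ((n ℕ.∸ k) C suc l)
    ≡⟨ cong (ℕ._* ((n ℕ.∸ k) C suc l)) (pascal n k) ⟩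
  (n C k ℕ.+ n C suc k) ℕ.* ((n ℕ.∸ k) C suc l)
    ≡⟨ ℕ.*-distribʳ-+ ((n ℕ.∸ k) C suc l) (n C k) (n C suc k) ⟩
  trinomial n k (suc l) ℕ.+ (n C suc k) ℕ.* ((n ℕ.∸ k) C suc l)
    ≡⟨ cong (trinomial n k (suc l) ℕ.+_) lower ⟩
  trinomial n k (suc l) ℕ.+ (trinomial n (suc k) l ℕ.+ trinomial n (suc k) (suc l))
    ≡⟨ ℕ.+-assoc (trinomial n k (suc l)) _ _ ⟨
  trinomial n k (suc l) ℕ.+ trinomial n (suc k) l ℕ.+ trinomial n (suc k) (suc l)
    ∎
  where
  open ≡-Reasoning
  lower : (n C suc k) ℕ.* ((n ℕ.∸ k) C suc l) ≡ trinomial n (suc k) l ℕ.+ trinomial n (suc k) (suc l)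
  lower with k ℕ.<? n
  -- For k ≥ n truncated subtraction spoils Pascal's rule in the second factor, but `n C suc k` is
  -- zero.
  ... | no k≮n rewrite k>n⇒nCk≡0 (s≤s (ℕ.≮⇒≥ k≮n)) = refl
  ... | yes k<n = trans
    (cong ((n C suc k) ℕ.*_) (trans (cong (_C suc l) (ℕ.+-∸-assoc 1 k<n)) (pascal (n ℕ.∸ suc k) l)))
    (ℕ.*-distribˡ-+ (n C suc k) _ _)

trinomial-pascalˡ : ∀ n l → trinomial (suc n) 0 (suc l) ≡ trinomial n 0 l ℕ.+ trinomial n 0 (suc l)
trinomial-pascalˡ n l = trans (trinomial-zeroˡ (suc n) (suc l))
  (trans (pascal n l) (sym (cong₂ ℕ._+_ (trinomial-zeroˡ n l) (trinomial-zeroˡ n (suc l)))))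

-- This is the palindromy of (1+x+x²)^n: the coefficients of x^(n-1) and x^(n+1) agree, which
-- explains the factor 2 in the recursion of `tˢ 0`.
trinomial-comm : ∀ n k l → trinomial n k l ≡ trinomial n l k
trinomial-comm n       zero    l       = trans (trinomial-zeroˡ n l) (sym (trinomial-zeroʳ n l))
trinomial-comm n       (suc k) zero    = trans (trinomial-zeroʳ n (suc k)) (sym (trinomial-zeroˡ n (suc k)))
trinomial-comm zero    (suc k) (suc l) = refl
trinomial-comm (suc n) (suc k) (suc l) = begin
  trinomial (suc n) (suc k) (suc l)
    ≡⟨ trinomial-pascal n k l ⟩
  trinomial n k (suc l) ℕ.+ trinomial n (suc k) l ℕ.+ trinomial n (suc k) (suc l)
    ≡⟨ cong₂ ℕ._+_ (cong₂ ℕ._+_ (trinomial-comm n k (suc l)) (trinomial-comm n (suc k) l)) (trinomial-comm n (suc k) (suc l)) ⟩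
  trinomial n (suc l) k ℕ.+ trinomial n l (suc k) ℕ.+ trinomial n (suc l) (suc k)
    ≡⟨ cong (ℕ._+ trinomial n (suc l) (suc k)) (ℕ.+-comm (trinomial n (suc l) k) _) ⟩
  trinomial n l (suc k) ℕ.+ trinomial n (suc l) k ℕ.+ trinomial n (suc l) (suc k)
    ≡⟨ trinomial-pascal n l k ⟨
  trinomial (suc n) (suc l) (suc k)
    ∎
  where open ≡-Reasoning

-- tˢ j n is the coefficient of x^(n+j) in (1+x+x²)^n.
tˢ : ℕ → ℕ → ℕ
tˢ zero    zero    = 1
tˢ (suc j) zero    = 0
tˢ zero    (suc n) = tˢ 0 n ℕ.+ 2 ℕ.* tˢ 1 n
tˢ (suc j) (suc n) = tˢ j n ℕ.+ tˢ (suc j) n ℕ.+ tˢ (suc (suc j)) n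

-- Among the n factors, k contribute 1 and k+j contribute x². The range N is left free because
-- Pascal's rule shifts k, so sums over different ranges occur; terms with k > n vanish.
∑-trinomial : ∀ n j N → n ℕ.< N → ∑ N (λ k → trinomial n k (k ℕ.+ j)) ≡ tˢ j n
∑-trinomial zero zero    (suc N) _ = cong suc (∑-zero N (λ _ → refl))
∑-trinomial zero (suc j) (suc N) _ = ∑-zero (suc N) {λ k → trinomial zero k (k ℕ.+ suc j)} (λ { zero → refl ; (suc _) → refl })
∑-trinomial (suc n) zero (suc N) (s≤s n<N) = begin
  trinomial (suc n) 0 0 ℕ.+ ∑ N (λ k → trinomial (suc n) (suc k) (suc (k ℕ.+ 0)))
    ≡⟨ cong suc (∑-cong N (λ {k} _ → trans (trinomial-pascal n k (k ℕ.+ 0)) (cong (ℕ._+ trinomial n (suc k) (suc (k ℕ.+ 0)))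
           (cong₂ ℕ._+_ (cong (trinomial n k) (sym (ℕ.+-suc k 0)))
             (trans (trinomial-comm n (suc k) (k ℕ.+ 0)) (cong₂ (trinomial n) (ℕ.+-identityʳ k) (ℕ.+-comm 1 k))))))) ⟩
  trinomial n 0 0 ℕ.+ ∑ N (λ k → φ 1 k ℕ.+ φ 1 k ℕ.+ φ 0 (suc k))
    ≡⟨ cong (trinomial n 0 0 ℕ.+_) (trans (∑-+ N (λ k → φ 1 k ℕ.+ φ 1 k) (φ 0 ∘ suc)) (cong (ℕ._+ ∑ N (φ 0 ∘ suc)) (∑-+ N (φ 1) (φ 1)))) ⟩
  trinomial n 0 0 ℕ.+ (∑ N (φ 1) ℕ.+ ∑ N (φ 1) ℕ.+ ∑ N (φ 0 ∘ suc))
    ≡⟨ solve 3 (λ a b c → a :+ (b :+ b :+ c) := (a :+ c) :+ con 2 :* b) refl (trinomial n 0 0) (∑ N (φ 1)) (∑ N (φ 0 ∘ suc)) ⟩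
  ∑ (suc N) (φ 0) ℕ.+ 2 ℕ.* ∑ N (φ 1)
    ≡⟨ cong₂ (λ a b → a ℕ.+ 2 ℕ.* b) (∑-trinomial n 0 (suc N) (ℕ.m<n⇒m<1+n n<N)) (∑-trinomial n 1 N n<N) ⟩
  tˢ 0 n ℕ.+ 2 ℕ.* tˢ 1 n
    ∎
  where
  open ≡-Reasoning
  open ℕ.+-*-Solver
  φ : ℕ → ℕ → ℕ
  φ j k = trinomial n k (k ℕ.+ j)
∑-trinomial (suc n) (suc j) (suc N) (s≤s n<N) = begin
  trinomial (suc n) 0 (suc j) ℕ.+ ∑ N (λ k → trinomial (suc n) (suc k) (suc (k ℕ.+ suc j)))
    ≡⟨ cong₂ ℕ._+_ (trinomial-pascalˡ n j)
         (∑-cong N (λ {k} _ → trans (trinomial-pascal n k (k ℕ.+ suc j)) (cong (ℕ._+ φ (suc j) (suc k))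
           (cong₂ ℕ._+_ (cong (trinomial n k) (sym (ℕ.+-suc k (suc j)))) (cong (trinomial n (suc k)) (ℕ.+-suc k j)))))) ⟩
  φ j 0 ℕ.+ φ (suc j) 0 ℕ.+ ∑ N (λ k → φ (suc (suc j)) k ℕ.+ φ j (suc k) ℕ.+ φ (suc j) (suc k))
    ≡⟨ cong (φ j 0 ℕ.+ φ (suc j) 0 ℕ.+_) (trans (∑-+ N (λ k → φ (suc (suc j)) k ℕ.+ φ j (suc k)) (φ (suc j) ∘ suc))
         (cong (ℕ._+ ∑ N (φ (suc j) ∘ suc)) (∑-+ N (φ (suc (suc j))) (φ j ∘ suc)))) ⟩
  φ j 0 ℕ.+ φ (suc j) 0 ℕ.+ (∑ N (φ (suc (suc j))) ℕ.+ ∑ N (φ j ∘ suc) ℕ.+ ∑ N (φ (suc j) ∘ suc))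
    ≡⟨ solve 5 (λ a b c d e → a :+ b :+ (c :+ d :+ e) := (a :+ d) :+ (b :+ e) :+ c) refl
         (φ j 0) (φ (suc j) 0) (∑ N (φ (suc (suc j)))) (∑ N (φ j ∘ suc)) (∑ N (φ (suc j) ∘ suc)) ⟩
  ∑ (suc N) (φ j) ℕ.+ ∑ (suc N) (φ (suc j)) ℕ.+ ∑ N (φ (suc (suc j)))
    ≡⟨ cong₂ ℕ._+_ (cong₂ ℕ._+_ (∑-trinomial n j (suc N) (ℕ.m<n⇒m<1+n n<N)) (∑-trinomial n (suc j) (suc N) (ℕ.m<n⇒m<1+n n<N)))
         (∑-trinomial n (suc (suc j)) N n<N) ⟩
  tˢ j n ℕ.+ tˢ (suc j) n ℕ.+ tˢ (suc (suc j)) n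
    ∎
  where
  open ≡-Reasoning
  open ℕ.+-*-Solver
  φ : ℕ → ℕ → ℕ
  φ j k = trinomial n k (k ℕ.+ j)

T≡tˢ : ∀ n → T n ≡ tˢ 0 n
T≡tˢ n = begin
  T n                                               ≡⟨ sum-map-applyUpTo (λ k → trinomial n k k) id (suc n) ⟩
  ∑ (suc n) (λ k → (n C k) ℕ.* ((n ℕ.∸ k) C k))     ≡⟨ ∑-cong (suc n) (λ {k} _ → cong (trinomial n k) (sym (ℕ.+-identityʳ k))) ⟩
  ∑ (suc n) (λ k → trinomial n k (k ℕ.+ 0))         ≡⟨ ∑-trinomial n 0 (suc n) ℕ.≤-refl ⟩
  tˢ 0 n                                            ∎
  where open ≡-Reasoning

-- Unimodality of (1+x+x²)^n, needed for the growth factor 3 of the central coefficient.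
tˢ-decreasing : ∀ j n → tˢ (suc j) n ℕ.≤ tˢ j n
tˢ-decreasing j       zero    = z≤n
tˢ-decreasing zero    (suc n) = begin
  tˢ 0 n ℕ.+ tˢ 1 n ℕ.+ tˢ 2 n      ≤⟨ ℕ.+-monoʳ-≤ (tˢ 0 n ℕ.+ tˢ 1 n) (tˢ-decreasing 1 n) ⟩
  tˢ 0 n ℕ.+ tˢ 1 n ℕ.+ tˢ 1 n      ≡⟨ solve 2 (λ a b → a :+ b :+ b := a :+ con 2 :* b) refl (tˢ 0 n) (tˢ 1 n) ⟩
  tˢ 0 n ℕ.+ 2 ℕ.* tˢ 1 n           ∎
  where
  open ℕ.≤-Reasoning
  open ℕ.+-*-Solver
tˢ-decreasing (suc j) (suc n) =
  ℕ.+-mono-≤ (ℕ.+-mono-≤ (tˢ-decreasing j n) (tˢ-decreasing (suc j) n)) (tˢ-decreasing (suc (suc j)) n)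

tˢ-suc≤3tˢ : ∀ n → tˢ 0 (suc n) ℕ.≤ 3 ℕ.* tˢ 0 n
tˢ-suc≤3tˢ n = ℕ.+-monoʳ-≤ (tˢ 0 n) (ℕ.*-monoʳ-≤ 2 (tˢ-decreasing 0 n))

-- Generating functions

Agree : ℕ → PS → PS → Set
Agree n f g = ∀ {i} → i ℕ.< n → f i ≡ g i

Agree-X⊛ : ∀ {n f g} → Agree n f g → Agree (suc n) (X ⊛ f) (X ⊛ g)
Agree-X⊛ {f = f} {g} f~g {zero}  _         = trans (X⊛-zero f) (sym (X⊛-zero g))
Agree-X⊛ {f = f} {g} f~g {suc i} (s≤s i<n) = trans (X⊛-suc f i) (trans (f~g i<n) (sym (X⊛-suc g i)))

Agree-⊛ : ∀ {n f f′ g g′} → Agree n f f′ → Agree n g g′ → Agree n (f ⊛ g) (f′ ⊛ g′)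
Agree-⊛ f~f′ g~g′ {i} i<n = ⊛-local i (λ j≤i → f~f′ (ℕ.≤-<-trans j≤i i<n)) (λ j≤i → g~g′ (ℕ.≤-<-trans j≤i i<n))

module FixedPoint (Φ : PS → PS) (contractive : ∀ {n f g} → Agree n f g → Agree (suc n) (Φ f) (Φ g)) where

  iterate : ℕ → PS
  iterate zero    = λ _ → + 0
  iterate (suc k) = Φ (iterate k)

  -- Each application of `Φ` settles one more coefficient, so coefficient n is final after n+1
  -- iterations and the diagonal is the limit.
  fix : PS
  fix n = iterate (suc n) n

  iterate-stable : ∀ k → Agree k (iterate k) (iterate (suc k))
  iterate-stable (suc k) = contractive {k} {iterate k} {iterate (suc k)} (iterate-stable k)

  iterate-fix : ∀ k → Agree k (iterate k) fix
  iterate-fix (suc k) {i} i<1+k with ℕ.m<1+n⇒m<n∨m≡n i<1+k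
  ... | inj₁ i<k  = trans (sym (iterate-stable k i<k)) (iterate-fix k i<k)
  ... | inj₂ refl = refl

  fix-fixed : fix ≐ Φ fix
  fix-fixed n = contractive {n} {iterate n} {fix} (iterate-fix n) (ℕ.n<1+n n)

1+X : PS
1+X = const (+ 1) ⊞ X

-- The fixed-point equation is the kernel equation κ = 0 solved for the term r of (1+x)r.
Φ : PS → PS
Φ f = const (+ 1) ⊞ X ⊛ ((1+X ⊛ (f ⊛ f)) ⊞ ⊟ f)

Φ-contractive : ∀ {n f g} → Agree n f g → Agree (suc n) (Φ f) (Φ g)
Φ-contractive {n} {f} {g} f~g {i} i<1+n = cong (_+_ (const (+ 1) i)) (Agree-X⊛ inner i<1+n)
  where
  inner : Agree n ((1+X ⊛ (f ⊛ f)) ⊞ ⊟ f) ((1+X ⊛ (g ⊛ g)) ⊞ ⊟ g)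
  inner j<n = cong₂ _+_ (Agree-⊛ {f = 1+X} {f′ = 1+X} (λ _ → refl) (Agree-⊛ {f = f} {g} {f} {g} f~g f~g) j<n)
                        (cong -_ (f~g j<n))

open FixedPoint Φ Φ-contractive using () renaming (fix to r; fix-fixed to r-fixed)

const-homomorphism : CommutativeRing.rawRing ℤ.+-*-commutativeRing
                       -Raw-AlmostCommutative⟶ fromCommutativeRing PS-commutativeRing
const-homomorphism = record
  { ⟦_⟧    = const
  ; +-homo = λ _ _ → λ { zero → refl ; (suc _) → refl }
  ; *-homo = λ a b → λ { zero → sym (⊛-zero (const a) (const b))
                       ; (suc n) → sym (trans (const-⊛ a (const b) (suc n)) (ℤ.*-zeroʳ a)) }
  ; -‿homo = λ _ → λ { zero → refl ; (suc _) → refl }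
  ; 0-homo = λ { zero → refl ; (suc _) → refl }
  ; 1-homo = λ _ → refl
  }

open KernelMethod PS-commutativeRing const-homomorphism

kernel : κ X r ≐ (λ _ → + 0)
kernel = kernel-from-fixed-point X r r-fixed

open Recurrences X r kernel

-- Uniqueness of power series solutions

Vanishes : ℕ → PS → Set
Vanishes n f = Agree n f (λ _ → + 0)

⊛0 : ∀ f → f ⊛ (λ _ → + 0) ≐ (λ _ → + 0)
⊛0 f n = trans (⊛-comm f (λ _ → + 0) n) (0⊛ f n)

vanishes-X⊛ : ∀ {n f} → Vanishes n f → Vanishes (suc n) (X ⊛ f)
vanishes-X⊛ {f = f} f~0 {i} i≤n = trans (Agree-X⊛ {f = f} f~0 i≤n) (⊛0 X i)

vanishes-⊛ : ∀ {n g} f → Vanishes n g → Vanishes n (f ⊛ g)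
vanishes-⊛ {g = g} f g~0 {i} i<n = trans (Agree-⊛ {f = f} {f} {g} (λ _ → refl) g~0 i<n) (⊛0 f i)

1+X⊛ : ∀ f n → (1+X ⊛ f) n ≡ f n + (X ⊛ f) n
1+X⊛ f n = trans (⊛-distribʳ-⊞ f (const (+ 1)) X n) (cong (λ t → t + (X ⊛ f) n) (1⊛ f n))

-- Lexicographic induction on precision and height: at `suc h` the terms with a factor x need only
-- precision n, and the remaining one is `d h` at the same precision but smaller height.
kernel-recurrence-zero : ∀ (d : ℕ → PS) → d 0 ≐ X ⊛ (1+X ⊛ d 1) →
  (∀ h → 1+X ⊛ d (suc h) ≐ d h ⊞ X ⊛ (1+X ⊛ d (suc (suc h)))) → ∀ h → d h ≐ (λ _ → + 0)
kernel-recurrence-zero d d₀ dₛ h n = vanishes (suc n) h (ℕ.n<1+n n)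
  where
  vanishes : ∀ n h → Vanishes n (d h)
  vanishes (suc n) zero    {i} i≤n = trans (d₀ i) (vanishes-X⊛ (vanishes-⊛ 1+X (vanishes n 1)) i≤n)
  vanishes (suc n) (suc h) {i} i≤n = begin
    d (suc h) i                          ≡⟨ ℤ.+-identityʳ _ ⟨
    d (suc h) i + + 0                    ≡⟨ cong (_+_ (d (suc h) i)) (vanishes-X⊛ (vanishes n (suc h)) i≤n) ⟨
    d (suc h) i + (X ⊛ d (suc h)) i      ≡⟨ 1+X⊛ (d (suc h)) i ⟨
    (1+X ⊛ d (suc h)) i                  ≡⟨ dₛ h i ⟩
    d h i + (X ⊛ (1+X ⊛ d (suc (suc h)))) i
                                         ≡⟨ cong₂ _+_ (vanishes (suc n) h i≤n) (vanishes-X⊛ (vanishes-⊛ 1+X (vanishes n (suc (suc h)))) i≤n) ⟩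
    + 0                                  ∎
    where open ≡-Reasoning

-- The whole right-hand side carries a factor x, so induction on the precision alone suffices.
trinomial-recurrence-zero : ∀ (d : ℕ → PS) → d 0 ≐ X ⊛ (d 0 ⊞ const (+ 2) ⊛ d 1) →
  (∀ j → d (suc j) ≐ X ⊛ (d j ⊞ d (suc j) ⊞ d (suc (suc j)))) → ∀ j → d j ≐ (λ _ → + 0)
trinomial-recurrence-zero d d₀ dₛ j n = vanishes (suc n) j (ℕ.n<1+n n)
  where
  vanishes : ∀ n j → Vanishes n (d j)
  vanishes (suc n) zero    {i} i≤n = trans (d₀ i) (vanishes-X⊛ (λ k<n →
    cong₂ _+_ (vanishes n 0 k<n) (vanishes-⊛ (const (+ 2)) (vanishes n 1) k<n)) i≤n)
  vanishes (suc n) (suc j) {i} i≤n = trans (dₛ j i) (vanishes-X⊛ (λ k<n →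
    cong₂ _+_ (cong₂ _+_ (vanishes n j k<n) (vanishes n (suc j) k<n)) (vanishes n (suc (suc j)) k<n)) i≤n)

-- The combinatorial sequences as power series

ι : (ℕ → ℕ) → PS
ι s n = + s n

≐-X⊛ : ∀ {f} v g → f 0 ≡ v 0 → (∀ n → f (suc n) ≡ v (suc n) + g n) → f ≐ v ⊞ X ⊛ g
≐-X⊛ v g f₀ fₛ zero    = trans f₀ (sym (trans (cong (_+_ (v 0)) (X⊛-zero g)) (ℤ.+-identityʳ (v 0))))
≐-X⊛ v g f₀ fₛ (suc n) = trans (fₛ n) (cong (_+_ (v (suc n))) (sym (X⊛-suc g n)))

≐X⊛ : ∀ {f} g → f 0 ≡ + 0 → (∀ n → f (suc n) ≡ g n) → f ≐ X ⊛ g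
≐X⊛ g f₀ fₛ zero    = trans f₀ (sym (X⊛-zero g))
≐X⊛ g f₀ fₛ (suc n) = trans (fₛ n) (sym (X⊛-suc g n))

height≐const : ∀ h → height h ≐ const (+ h)
height≐const zero    n       = refl
height≐const (suc h) zero    = cong (_+_ (+ 1)) (height≐const h zero)
height≐const (suc h) (suc n) = cong (_+_ (+ 0)) (height≐const h (suc n))

height-⊛ : ∀ h s n → (height h ⊛ ι s) n ≡ + (h ℕ.* s n)
height-⊛ h s n = trans (⊛-congˡ (ι s) (height≐const h) n)
  (trans (const-⊛ (+ h) (ι s) n) (sym (ℤ.pos-* h (s n))))

gˢ-series : ∀ h → ι (gˢ h) ≐ const (+ 1) ⊞ X ⊛ ι (fˢ (suc h))
gˢ-series h = ≐-X⊛ (const (+ 1)) (ι (fˢ (suc h))) refl (λ n → refl)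

fˢ-series-zero : ι (fˢ 0) ≐ ι (gˢ 0)
fˢ-series-zero zero    = refl
fˢ-series-zero (suc n) = cong +_ (ℕ.+-identityʳ _)

fˢ-series-suc : ∀ h → ι (fˢ (suc h)) ⊞ ι (gˢ h) ≐ ι (fˢ h) ⊞ ι (gˢ (suc h)) ⊞ X ⊛ ι (gˢ (suc h))
fˢ-series-suc h = ≐-X⊛ (ι (fˢ h) ⊞ ι (gˢ (suc h))) (ι (gˢ (suc h))) refl (λ n → cong +_ (fˢ-suc h n))

bˢ-series : ∀ h → ι (bˢ h) ≐ X ⊛ (height (suc h) ⊛ ι (fˢ (suc h)) ⊞ ι (aˢ (suc h)))
bˢ-series h = ≐X⊛ (height (suc h) ⊛ ι (fˢ (suc h)) ⊞ ι (aˢ (suc h))) refl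
  (λ n → sym (cong (λ t → t + + aˢ (suc h) n) (height-⊛ (suc h) (fˢ (suc h)) n)))

aˢ-series-zero : ι (aˢ 0) ≐ ι (bˢ 0)
aˢ-series-zero zero    = refl
aˢ-series-zero (suc n) = cong +_ (ℕ.+-identityʳ _)

aˢ-series-suc : ∀ h → ι (aˢ (suc h)) ⊞ ι (bˢ h) ≐
  ι (aˢ h) ⊞ ι (bˢ (suc h)) ⊞ X ⊛ (height (suc h) ⊛ ι (gˢ (suc h)) ⊞ ι (bˢ (suc h)))
aˢ-series-suc h = ≐-X⊛ (ι (aˢ h) ⊞ ι (bˢ (suc h))) (height (suc h) ⊛ ι (gˢ (suc h)) ⊞ ι (bˢ (suc h))) refl
  (λ n → trans (cong +_ (aˢ-suc h n))
    (sym (cong (λ t → + aˢ h (suc n) + + bˢ (suc h) (suc n) + (t + + bˢ (suc h) n)) (height-⊛ (suc h) (gˢ (suc h)) n))))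

tˢ-series-zero : ι (tˢ 0) ≐ const (+ 1) ⊞ X ⊛ (ι (tˢ 0) ⊞ const (+ 2) ⊛ ι (tˢ 1))
tˢ-series-zero = ≐-X⊛ (const (+ 1)) (ι (tˢ 0) ⊞ const (+ 2) ⊛ ι (tˢ 1)) refl
  (λ n → trans (cong (λ t → + tˢ 0 n + t) (trans (ℤ.pos-* 2 (tˢ 1 n)) (sym (const-⊛ (+ 2) (ι (tˢ 1)) n))))
               (sym (ℤ.+-identityˡ _)))

tˢ-series-suc : ∀ j → ι (tˢ (suc j)) ≐ X ⊛ (ι (tˢ j) ⊞ ι (tˢ (suc j)) ⊞ ι (tˢ (suc (suc j))))
tˢ-series-suc j = ≐X⊛ (ι (tˢ j) ⊞ ι (tˢ (suc j)) ⊞ ι (tˢ (suc (suc j)))) refl (λ n → refl)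

module Areas = AreaRecurrence kernel-recurrence-zero
  (ι ∘ fˢ) (ι ∘ gˢ) (ι ∘ aˢ) (ι ∘ bˢ)
  gˢ-series fˢ-series-zero fˢ-series-suc bˢ-series aˢ-series-zero aˢ-series-suc

module Trinomials = CentralTrinomial trinomial-recurrence-zero (ι ∘ tˢ) tˢ-series-zero tˢ-series-suc

U≐bˢ : U ≐ ι (bˢ 0)
U≐bˢ zero    = refl
U≐bˢ (suc n) = cong +_ (u≡bˢ (suc n))

poly≐horner : ∀ cs → poly cs ≐ horner X cs
poly≐horner []       zero    = refl
poly≐horner []       (suc n) = refl
poly≐horner (c ∷ cs) = ≐-X⊛ (const c) (horner X cs) refl
  (λ n → trans (poly≐horner cs n) (sym (ℤ.+-identityˡ _)))

powersOf3 : PS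
powersOf3 = ι (3 ^_)

powersOf3-geometric : powersOf3 ≐ const (+ 1) ⊞ X ⊛ (const (+ 3) ⊛ powersOf3)
powersOf3-geometric = ≐-X⊛ (const (+ 1)) (const (+ 3) ⊛ powersOf3) refl
  (λ n → trans (ℤ.pos-* 3 (3 ^ n)) (sym (trans (ℤ.+-identityˡ _) (const-⊛ (+ 3) powersOf3 n))))

module Closed = ClosedForm (ι (bˢ 0)) (ι (tˢ 0)) powersOf3
  Areas.generating-function (Trinomials.St≈zpow 0) powersOf3-geometric

X⊛⁴ : ∀ f n → (X ⊛ (X ⊛ (X ⊛ (X ⊛ f)))) (4 ℕ.+ n) ≡ f n
X⊛⁴ f n = trans (X⊛-suc (X ⊛ (X ⊛ (X ⊛ f))) (3 ℕ.+ n)) (trans (X⊛-suc (X ⊛ (X ⊛ f)) (2 ℕ.+ n))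
  (trans (X⊛-suc (X ⊛ f) (1 ℕ.+ n)) (X⊛-suc f n)))

functional-equation : ∀ n → (poly (+ 0 ∷ + 0 ∷ + 0 ∷ + 0 ∷ -[1+ 1 ] ∷ + 4 ∷ + 6 ∷ []) ⊛ U) n
  ≡ (poly (-[1+ 0 ] ∷ + 3 ∷ + 1 ∷ -[1+ 1 ] ∷ []) ⊛ S X r) n + poly (+ 1 ∷ -[1+ 3 ] ∷ + 0 ∷ + 7 ∷ + 2 ∷ []) n
functional-equation n = begin
  (poly p₁ ⊛ U) n                               ≡⟨ ⊛-cong (poly≐horner p₁) U≐bˢ n ⟩
  (horner X p₁ ⊛ ι (bˢ 0)) n                    ≡⟨ Areas.generating-function n ⟩
  (horner X p₂ ⊛ S X r) n + horner X p₃ n       ≡⟨ cong₂ _+_ (⊛-congˡ (S X r) (poly≐horner p₂) n) (poly≐horner p₃ n) ⟨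
  (poly p₂ ⊛ S X r) n + poly p₃ n               ∎
  where
  open ≡-Reasoning
  p₁ p₂ p₃ : List ℤ
  p₁ = + 0 ∷ + 0 ∷ + 0 ∷ + 0 ∷ -[1+ 1 ] ∷ + 4 ∷ + 6 ∷ []
  p₂ = -[1+ 0 ] ∷ + 3 ∷ + 1 ∷ -[1+ 1 ] ∷ []
  p₃ = + 1 ∷ -[1+ 3 ] ∷ + 0 ∷ + 7 ∷ + 2 ∷ []

S-squared : ∀ n → (S X r ⊛ S X r) n ≡ poly (+ 1 ∷ -[1+ 1 ] ∷ -[1+ 2 ] ∷ []) n
S-squared n = trans (S²≈D n) (trans (D-expanded X n) (sym (poly≐horner (+ 1 ∷ -[1+ 1 ] ∷ -[1+ 2 ] ∷ []) n)))

2u-tˢ : ∀ n → + 2 * + u n ≡ + (3 ^ suc n) + + 2 * + tˢ 0 (1 ℕ.+ n) - + tˢ 0 (2 ℕ.+ n)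
                             - + 3 * + tˢ 0 (3 ℕ.+ n) + + tˢ 0 (4 ℕ.+ n)
2u-tˢ n = begin
  + 2 * + u n                                                 ≡⟨ cong (λ m → + 2 * + m) (u≡bˢ n) ⟩
  + 2 * + bˢ 0 n                                              ≡⟨ const-⊛ (+ 2) (ι (bˢ 0)) n ⟨
  (const (+ 2) ⊛ ι (bˢ 0)) n                                  ≡⟨ X⊛⁴ (const (+ 2) ⊛ ι (bˢ 0)) n ⟨
  (X ⊛ (X ⊛ (X ⊛ (X ⊛ (const (+ 2) ⊛ ι (bˢ 0)))))) (4 ℕ.+ n)  ≡⟨ Closed.closed-form (4 ℕ.+ n) ⟩
  (X ⊛ (X ⊛ (X ⊛ (X ⊛ (const (+ 3) ⊛ powersOf3))))) (4 ℕ.+ n) + (horner X q ⊛ t) (4 ℕ.+ n) - horner X q′ (4 ℕ.+ n)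
                                                              -- The polynomial `q′` is cubic, so it
                                                              -- has no coefficient in degree 4+n;
                                                              -- it only compensates the first four
                                                              -- terms of the trinomial part.
                                                              ≡⟨ cong₂ _-_ (cong₂ _+_ powers trinomials) (sym (poly≐horner q′ (4 ℕ.+ n))) ⟩
  + (3 ^ suc n) + (+ 1 * t (4 ℕ.+ n) + (-[1+ 2 ] * t (3 ℕ.+ n) + (-[1+ 0 ] * t (2 ℕ.+ n) + (+ 2 * t (1 ℕ.+ n) + + 0)))) - + 0
                                                              ≡⟨ solve 5 (λ p a b c d →
                                                                   p :+ (con (+ 1) :* d :+ (con -[1+ 2 ] :* c :+ (con -[1+ 0 ] :* b :+ (con (+ 2) :* a :+ con (+ 0))))) :- con (+ 0)
                                                                   := p :+ con (+ 2) :* a :- b :- con (+ 3) :* c :+ d)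
                                                                   refl (+ (3 ^ suc n)) (t (1 ℕ.+ n)) (t (2 ℕ.+ n)) (t (3 ℕ.+ n)) (t (4 ℕ.+ n)) ⟩
  _                                                           ∎
  where
  open ≡-Reasoning
  open +-*-Solver using (solve; con; _:+_; _:*_; _:-_; _:=_)
  t : PS
  t = ι (tˢ 0)
  q q′ : List ℤ
  q  = + 1 ∷ -[1+ 2 ] ∷ -[1+ 0 ] ∷ + 2 ∷ []
  q′ = + 1 ∷ -[1+ 1 ] ∷ -[1+ 0 ] ∷ -[1+ 0 ] ∷ []
  powers : (X ⊛ (X ⊛ (X ⊛ (X ⊛ (const (+ 3) ⊛ powersOf3))))) (4 ℕ.+ n) ≡ + (3 ^ suc n)
  powers = trans (X⊛⁴ (const (+ 3) ⊛ powersOf3) n) (trans (const-⊛ (+ 3) powersOf3 n) (sym (ℤ.pos-* 3 (3 ^ n))))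
  trinomials : (horner X q ⊛ t) (4 ℕ.+ n) ≡
    + 1 * t (4 ℕ.+ n) + (-[1+ 2 ] * t (3 ℕ.+ n) + (-[1+ 0 ] * t (2 ℕ.+ n) + (+ 2 * t (1 ℕ.+ n) + + 0)))
  trinomials = begin
    (horner X q ⊛ t) (4 ℕ.+ n)
      ≡⟨ ⊛-congˡ t (poly≐horner q) (4 ℕ.+ n) ⟨
    (poly q ⊛ t) (4 ℕ.+ n)
      ≡⟨ ⊛-suc (poly q) t (3 ℕ.+ n) ⟩
    + 1 * t (4 ℕ.+ n) + (poly (-[1+ 2 ] ∷ -[1+ 0 ] ∷ + 2 ∷ []) ⊛ t) (3 ℕ.+ n)
      ≡⟨ cong (_+_ (+ 1 * t (4 ℕ.+ n))) (trans (⊛-suc (poly (-[1+ 2 ] ∷ -[1+ 0 ] ∷ + 2 ∷ [])) t (2 ℕ.+ n))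
           (cong (_+_ (-[1+ 2 ] * t (3 ℕ.+ n))) (trans (⊛-suc (poly (-[1+ 0 ] ∷ + 2 ∷ [])) t (1 ℕ.+ n))
             (cong (_+_ (-[1+ 0 ] * t (2 ℕ.+ n))) (trans (⊛-suc (poly (+ 2 ∷ [])) t n)
               (cong (_+_ (+ 2 * t (1 ℕ.+ n))) (0⊛ t n))))))) ⟩
    _ ∎

-- Asymptotics

ι-⊛ : ∀ f g n → (ι f ⊛ ι g) n ≡ + ∑ (suc n) (λ i → f i ℕ.* g (n ℕ.∸ i))
ι-⊛ f g zero    = trans (⊛-zero (ι f) (ι g)) (trans (sym (ℤ.pos-* (f 0) (g 0))) (cong +_ (sym (ℕ.+-identityʳ _))))
ι-⊛ f g (suc n) = trans (⊛-suc (ι f) (ι g) n) (cong₂ _+_ (sym (ℤ.pos-* (f 0) (g (suc n)))) (ι-⊛ (f ∘ suc) g n))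

-- The coefficients of (1+x)T² are the powers of 3; dropping the nonnegative contribution of x T²
-- leaves the bound.
tˢ-convolution≤ : ∀ n → ∑ (suc n) (λ i → tˢ 0 i ℕ.* tˢ 0 (n ℕ.∸ i)) ℕ.≤ 3 ^ n
tˢ-convolution≤ zero    = ℕ.≤-refl
tˢ-convolution≤ (suc n) = ℕ.≤-trans (ℕ.m≤m+n _ (convolution n)) (ℕ.≤-reflexive (ℤ.+-injective (begin
  + convolution (suc n) + + convolution n                ≡⟨ cong₂ _+_ (ι-⊛ (tˢ 0) (tˢ 0) (suc n)) (ι-⊛ (tˢ 0) (tˢ 0) n) ⟨
  (t ⊛ t) (suc n) + (t ⊛ t) n                            ≡⟨ cong (_+_ ((t ⊛ t) (suc n))) (X⊛-suc (t ⊛ t) n) ⟨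
  (t ⊛ t) (suc n) + (X ⊛ (t ⊛ t)) (suc n)                ≡⟨ 1+X⊛ (t ⊛ t) (suc n) ⟨
  (1+X ⊛ (t ⊛ t)) (suc n)                                ≡⟨ Closed.T²-relation (suc n) ⟩
  + (3 ^ suc n)                                          ∎)))
  where
  open ≡-Reasoning
  t : PS
  t = ι (tˢ 0)
  convolution : ℕ → ℕ
  convolution n = ∑ (suc n) (λ i → tˢ 0 i ℕ.* tˢ 0 (n ℕ.∸ i))

tˢ-growth : ∀ k n → tˢ 0 (k ℕ.+ n) ℕ.≤ 3 ^ k ℕ.* tˢ 0 n
tˢ-growth zero    n = ℕ.≤-reflexive (sym (ℕ.+-identityʳ _))
tˢ-growth (suc k) n = begin
  tˢ 0 (suc k ℕ.+ n)            ≤⟨ tˢ-suc≤3tˢ (k ℕ.+ n) ⟩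
  3 ℕ.* tˢ 0 (k ℕ.+ n)          ≤⟨ ℕ.*-monoʳ-≤ 3 (tˢ-growth k n) ⟩
  3 ℕ.* (3 ^ k ℕ.* tˢ 0 n)      ≡⟨ ℕ.*-assoc 3 (3 ^ k) _ ⟨
  3 ^ suc k ℕ.* tˢ 0 n          ∎
  where open ℕ.≤-Reasoning

∑-≥ : ∀ n {φ c} → (∀ {i} → i ℕ.< n → c ℕ.≤ φ i) → n ℕ.* c ℕ.≤ ∑ n φ
∑-≥ zero    c≤φ = z≤n
∑-≥ (suc n) c≤φ = ℕ.+-mono-≤ (c≤φ (s≤s z≤n)) (∑-≥ n (c≤φ ∘ s≤s))

-- t(n) ≤ 3^(n-i) t(i) makes 3^n t(i) t(n-i) ≥ t(n)², to be summed over i.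
tˢ-square-bound : ∀ n → suc n ℕ.* (tˢ 0 n ℕ.* tˢ 0 n) ℕ.≤ 3 ^ n ℕ.* 3 ^ n
tˢ-square-bound n = begin
  suc n ℕ.* (t n ℕ.* t n)                                ≤⟨ ∑-≥ (suc n) (term ∘ s≤s⁻¹) ⟩
  ∑ (suc n) (λ i → 3 ^ n ℕ.* (t i ℕ.* t (n ℕ.∸ i)))      ≡⟨ ∑-* (suc n) (3 ^ n) (λ i → t i ℕ.* t (n ℕ.∸ i)) ⟩
  3 ^ n ℕ.* ∑ (suc n) (λ i → t i ℕ.* t (n ℕ.∸ i))        ≤⟨ ℕ.*-monoʳ-≤ (3 ^ n) (tˢ-convolution≤ n) ⟩
  3 ^ n ℕ.* 3 ^ n                                        ∎
  where
  open ℕ.≤-Reasoning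
  t : ℕ → ℕ
  t = tˢ 0
  term : ∀ {i} → i ℕ.≤ n → t n ℕ.* t n ℕ.≤ 3 ^ n ℕ.* (t i ℕ.* t (n ℕ.∸ i))
  term {i} i≤n = begin
    t n ℕ.* t n
      ≡⟨ cong₂ (λ a b → t a ℕ.* t b) (ℕ.m∸n+n≡m i≤n) (ℕ.m+[n∸m]≡n i≤n) ⟨
    t (n ℕ.∸ i ℕ.+ i) ℕ.* t (i ℕ.+ (n ℕ.∸ i))
      ≤⟨ ℕ.*-mono-≤ (tˢ-growth (n ℕ.∸ i) i) (tˢ-growth i (n ℕ.∸ i)) ⟩
    3 ^ (n ℕ.∸ i) ℕ.* t i ℕ.* (3 ^ i ℕ.* t (n ℕ.∸ i))
      ≡⟨ ℕ.+-*-Solver.solve 4 (λ a b c d → a :* b :* (c :* d) := a :* c :* (b :* d)) refl (3 ^ (n ℕ.∸ i)) (t i) (3 ^ i) (t (n ℕ.∸ i)) ⟩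
    3 ^ (n ℕ.∸ i) ℕ.* 3 ^ i ℕ.* (t i ℕ.* t (n ℕ.∸ i))
      ≡⟨ cong (ℕ._* (t i ℕ.* t (n ℕ.∸ i))) (trans (sym (ℕ.^-distribˡ-+-* 3 (n ℕ.∸ i) i)) (cong (3 ^_) (ℕ.m∸n+n≡m i≤n))) ⟩
    3 ^ n ℕ.* (t i ℕ.* t (n ℕ.∸ i))
      ∎
    where open ℕ.+-*-Solver using (_:*_; _:=_)

-- Otherwise 9^n ≤ c² t² ≤ n t² < (n+1) t², against `tˢ-square-bound`.
tˢ-negligible : ∀ c n → c ℕ.* c ℕ.≤ n → c ℕ.* tˢ 0 n ℕ.< 3 ^ n
tˢ-negligible c n c²≤n with ℕ.<-≤-connex (c ℕ.* tˢ 0 n) (3 ^ n)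
... | inj₁ ct<3ⁿ = ct<3ⁿ
... | inj₂ 3ⁿ≤ct = contradiction (tˢ-square-bound n) (ℕ.<⇒≱ (begin-strict
  3 ^ n ℕ.* 3 ^ n                ≤⟨ ℕ.*-mono-≤ 3ⁿ≤ct 3ⁿ≤ct ⟩
  c ℕ.* t ℕ.* (c ℕ.* t)          ≡⟨ ℕ.+-*-Solver.solve 2 (λ c t → c :* t :* (c :* t) := c :* c :* (t :* t)) refl c t ⟩
  c ℕ.* c ℕ.* (t ℕ.* t)          ≤⟨ ℕ.*-monoˡ-≤ (t ℕ.* t) c²≤n ⟩
  n ℕ.* (t ℕ.* t)                <⟨ ℕ.m<n+m (n ℕ.* (t ℕ.* t)) (ℕ.*-mono-< t>0 t>0) ⟩
  suc n ℕ.* (t ℕ.* t)            ∎))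
  where
  open ℕ.≤-Reasoning
  open ℕ.+-*-Solver using (_:*_; _:=_)
  t : ℕ
  t = tˢ 0 n
  -- Positivity makes the inequality above strict; it follows from the refuted assumption 3^n ≤ c t.
  t>0 : 0 ℕ.< t
  t>0 = ℕ.n≢0⇒n>0 λ t≡0 → contradiction
    (ℕ.≤-trans (ℕ.m^n>0 3 n) (ℕ.≤-trans 3ⁿ≤ct (ℕ.≤-reflexive (trans (cong (c ℕ.*_) t≡0) (ℕ.*-zeroʳ c))))) (λ ())

-- By the growth factor 3 the positive trinomial terms amount to at most 2 + 27 and the negative
-- ones to at most 3 + 3·9 multiples of `tˢ 0 (suc n)`; a difference of naturals is bounded by the
-- larger.
∣2u-3ⁿ∣≤ : ∀ n → ∣ + 2 * + u n - + (3 ^ suc n) ∣ ℕ.≤ 30 ℕ.* tˢ 0 (suc n)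
∣2u-3ⁿ∣≤ n = begin
  ∣ + 2 * + u n - + (3 ^ suc n) ∣       ≡⟨ cong ∣_∣ difference ⟩
  ∣ p ℤ.⊖ q ∣                           ≤⟨ ℤ.∣m⊝n∣≤m⊔n p q ⟩
  p ℕ.⊔ q                               ≤⟨ ℕ.⊔-lub p≤ q≤ ⟩
  30 ℕ.* t 0                            ∎
  where
  open ℕ.≤-Reasoning
  t : ℕ → ℕ
  t k = tˢ 0 (k ℕ.+ suc n)
  p q : ℕ
  p = 2 ℕ.* t 0 ℕ.+ t 3
  q = t 1 ℕ.+ 3 ℕ.* t 2
  p≤ : p ℕ.≤ 30 ℕ.* t 0
  p≤ = begin
    2 ℕ.* t 0 ℕ.+ t 3            ≤⟨ ℕ.+-monoʳ-≤ (2 ℕ.* t 0) (tˢ-growth 3 (suc n)) ⟩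
    2 ℕ.* t 0 ℕ.+ 27 ℕ.* t 0     ≡⟨ ℕ.*-distribʳ-+ (t 0) 2 27 ⟨
    29 ℕ.* t 0                   ≤⟨ ℕ.m≤n+m (29 ℕ.* t 0) (t 0) ⟩
    30 ℕ.* t 0                   ∎
  q≤ : q ℕ.≤ 30 ℕ.* t 0
  q≤ = begin
    t 1 ℕ.+ 3 ℕ.* t 2                      ≤⟨ ℕ.+-mono-≤ (tˢ-growth 1 (suc n)) (ℕ.*-monoʳ-≤ 3 (tˢ-growth 2 (suc n))) ⟩
    3 ℕ.* t 0 ℕ.+ 3 ℕ.* (9 ℕ.* t 0)        ≡⟨ cong (3 ℕ.* t 0 ℕ.+_) (ℕ.*-assoc 3 9 (t 0)) ⟨
    3 ℕ.* t 0 ℕ.+ 27 ℕ.* t 0               ≡⟨ ℕ.*-distribʳ-+ (t 0) 3 27 ⟨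
    30 ℕ.* t 0                             ∎
  difference : + 2 * + u n - + (3 ^ suc n) ≡ p ℤ.⊖ q
  difference = trans (cong (λ z → z - + (3 ^ suc n)) (2u-tˢ n)) (trans
    (solve 5 (λ p a b c d → p :+ con (+ 2) :* a :- b :- con (+ 3) :* c :+ d :- p
                            := con (+ 2) :* a :+ d :- (b :+ con (+ 3) :* c))
      refl (+ (3 ^ suc n)) (+ t 0) (+ t 1) (+ t 2) (+ t 3)) (trans
    (sym (cong₂ (λ a b → a + + t 3 - (+ t 1 + b)) (ℤ.pos-* 2 (t 0)) (ℤ.pos-* 3 (t 2))))
    (ℤ.m-n≡m⊖n p q)))
    where open +-*-Solver

-- The relative error of 3^(n+1)/2 drops below 1/(k+1). The threshold is the square of c = 30(k+1),
-- as `tˢ-negligible` requires.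
asymptotics : ∀ k → ∃ λ N → ∀ n → n ≥ N → + suc k * + ∣ + 2 * + u n - + (3 ^ suc n) ∣ < + (3 ^ suc n)
asymptotics k = c ℕ.* c , λ n n≥N →
  subst (_< + (3 ^ suc n)) (ℤ.pos-* (suc k) ∣ + 2 * + u n - + (3 ^ suc n) ∣) (ℤ.+<+ (begin-strict
    suc k ℕ.* ∣ + 2 * + u n - + (3 ^ suc n) ∣      ≤⟨ ℕ.*-monoʳ-≤ (suc k) (∣2u-3ⁿ∣≤ n) ⟩
    suc k ℕ.* (30 ℕ.* tˢ 0 (suc n))                ≡⟨ ℕ.*-assoc (suc k) 30 (tˢ 0 (suc n)) ⟨
    c ℕ.* tˢ 0 (suc n)                             <⟨ tˢ-negligible c (suc n) (ℕ.m≤n⇒m≤1+n n≥N) ⟩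
    3 ^ suc n                                      ∎))
  where
  open ℕ.≤-Reasoning
  c : ℕ
  c = suc k ℕ.* 30

-- The sequence is a variable so that rewriting meets opaque terms instead of the defining sum of
-- `T`.
closed-form : ∀ (t : ℕ → ℕ) → (∀ n → t n ≡ tˢ 0 n) → ∀ n →
  + 2 * + u n ≡ + (3 ^ suc n) + + 2 * + t (1 ℕ.+ n) - + t (2 ℕ.+ n) - + 3 * + t (3 ℕ.+ n) + + t (4 ℕ.+ n)
closed-form t t≡tˢ n
  rewrite t≡tˢ (1 ℕ.+ n) | t≡tˢ (2 ℕ.+ n) | t≡tˢ (3 ℕ.+ n) | t≡tˢ (4 ℕ.+ n) = 2u-tˢ n

theorem4p3 : Σ PS (λ S → (S 0 ≡ + 1)
    × (∀ n → (S ⊛ S) n ≡ poly (+ 1 ∷ -[1+ 1 ] ∷ -[1+ 2 ] ∷ []) n)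
    × (∀ n → (poly (+ 0 ∷ + 0 ∷ + 0 ∷ + 0 ∷ -[1+ 1 ] ∷ + 4 ∷ + 6 ∷ []) ⊛ U) n
    ≡ (poly (-[1+ 0 ] ∷ + 3 ∷ + 1 ∷ -[1+ 1 ] ∷ []) ⊛ S) n
    + poly (+ 1 ∷ -[1+ 3 ] ∷ + 0 ∷ + 7 ∷ + 2 ∷ []) n))
    × (∀ (n : ℕ) → n ≥ 1 →
    + 2 * + u n ≡ + (3 ^ suc n) + + 2 * + T (suc n) - + T (suc (suc n))
    - + 3 * + T (suc (suc (suc n))) + + T (suc (suc (suc (suc n)))))
    × (∀ (k : ℕ) → ∃ λ (N : ℕ) → ∀ (n : ℕ) → n ≥ N →
    + suc k * + ∣ + 2 * + u n - + (3 ^ suc n) ∣ < + (3 ^ suc n))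
theorem4p3 = (S X r , refl , S-squared , functional-equation) , (λ n _ → closed-form T T≡tˢ n) , asymptotics
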